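{- For every $n\geq 4$, \[ 2C(n-2)+C(n-3)\leq \lvert\operatorname{Arith}(D_n)\rvert < 2C(n-2)+702\,C(n-3), \] where $C(j)=\frac{1}{j+1}\binom{2j}{j}$ is the $j$-th Catalan number.
   Context: For $n\ge 3$ let $\ell=n-3$. The bident $D_n$ is the graph with vertices $v_x,v_y,v_0,v_1,\dots,v_\ell$ and edges $v_xv_0$, $v_yv_0$, and $v_iv_{i+1}$ for $0\le i\le \ell-1$. For a finite connected graph $G$ with adjacency matrix $A$, an arithmetical structure on $G$ is a pair $(\mathbf d,\mathbf r)$ of vectors with positive integer entries indexed by the vertices such that $(\operatorname{diag}(\mathbf d)-A)\mathbf r=\mathbf 0$ and the entries of $\mathbf r$ have no nontrivial common factor. $\operatorname{Arith}(D_n)$ is the set of arithmetical structures on $D_n$. -}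

module Defs where

open import Data.Nat using (ℕ; zero; suc; _*_; _<_; _≡ᵇ_; _/_)
open import Data.Nat.Divisibility using (_∣_)
open import Data.Nat.Combinatorics using (_C_)
open import Data.Bool using (if_then_else_; _∨_)
open import Data.Fin using (Fin; toℕ)
open import Data.Vec using (Vec; lookup; tabulate; sum)
open import Data.Product using (Σ; _×_)
open import Data.List using (List; length)
open import Data.List.Membership.Propositional using (_∈_)
open import Data.List.Relation.Unary.Unique.Propositional using (Unique)
open import Function.Bundles using (_⇔_)
open import Relation.Binary.PropositionalEquality using (_≡_)

catalan : ℕ → ℕ
catalan j = ((j + j) C j) / suc j
  where open Data.Nat using (_+_)

-- Arithmetical structure (d , r) on a graph with n vertices and adjacency
-- matrix A (entries in ℕ).  The condition (diag d - A) r = 0 is written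
-- componentwise as d_i r_i = Σ_j A_ij r_j (all quantities are naturals).
IsArithmetical : {n : ℕ} → (Fin n → Fin n → ℕ) → Vec ℕ n × Vec ℕ n → Set
IsArithmetical {n} A (d Data.Product., r) =
  ((i : Fin n) → 0 < lookup d i) ×
  ((i : Fin n) → 0 < lookup r i) ×
  ((i : Fin n) → lookup d i * lookup r i ≡ sum (tabulate (λ j → A i j * lookup r j))) ×
  ((k : ℕ) → ((i : Fin n) → k ∣ lookup r i) → k ≡ 1)

-- Vertex numbering of the bident D_n (n vertices):
--   0 ↦ v_x,  1 ↦ v_y,  2 + i ↦ v_i  (0 ≤ i ≤ ℓ = n - 3).
-- Edges: v_x v_0, v_y v_0, v_i v_{i+1}.
bidentAdjℕ : ℕ → ℕ → ℕ
bidentAdjℕ 0 2 = 1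
bidentAdjℕ 2 0 = 1
bidentAdjℕ 1 2 = 1
bidentAdjℕ 2 1 = 1
bidentAdjℕ (suc (suc i)) (suc (suc j)) =
  if (suc i ≡ᵇ j) ∨ (suc j ≡ᵇ i) then 1 else 0
bidentAdjℕ _ _ = 0

bidentAdj : (n : ℕ) → Fin n → Fin n → ℕ
bidentAdj n i j = bidentAdjℕ (toℕ i) (toℕ j)

ArithBident : (n : ℕ) → Vec ℕ n × Vec ℕ n → Set
ArithBident n = IsArithmetical (bidentAdj n)

HasCardinality : {A : Set} → (A → Set) → ℕ → Set
HasCardinality {A} P k =
  Σ (List A) (λ L → Unique L × ((x : A) → (x ∈ L) ⇔ P x) × length L ≡ k)

{-# OPTIONS --safe #-}
-- Put p = r_x and q = r_y.  Then p and q are coprime, r₀ = u q with p ∣ u, and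
-- r₁ ≡ −(p + q) modulo r₀.  Every tail r₁, …, r_ℓ arises from the minimal one,
-- whose length K is that of a negative continued fraction, by repeatedly
-- inserting r_i + r_{i+1} between neighbours, so for ℓ = n − 3 the number of
-- tails is the ballot number (K + 1) / (ℓ + 1) · binom(2ℓ − K, ℓ), which is at
-- most (K + 1) 2^(−K) C(ℓ).
-- For u = 1 one finds p = 1 and K = q − 1; these vectors, their mirror images
-- and p = q = 1, u ≤ 3 account for the lower bound.  If p < q and u ≥ 2, then K
-- grows with u and with (p + q) / p u, so that the remaining contributions
-- add up to a convergent series times C(ℓ), whose value is below 702.
module Submission where

open import Defs
open import Data.Nat using (ℕ; _≤_; _<_; _+_; _*_; _∸_)
open import Data.Product using (Σ; _×_)
open import Data.Nat
open import Data.Nat.Combinatorics using (_C_; nCk+nC[k+1]≡[n+1]C[k+1]; nCk≡nC[n∸k]; nC1≡n; k>n⇒nCk≡0)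
open import Data.Nat.Coprimality as Coprimality using (Coprime; coprime?; coprime-divisor; 1-coprimeTo)
open import Data.Nat.Divisibility
open import Data.Nat.DivMod
open import Data.Nat.Induction using (<-rec)
open import Data.Nat.ListAction using (sum)
open import Data.Nat.Properties
open import Data.Nat.Tactic.RingSolver using (solve-∀)
open import Data.Empty using (⊥; ⊥-elim)
open import Data.Fin using (Fin; zero; suc; toℕ)
open import Data.List using (List; []; _∷_; _++_; map; length; concat; applyUpTo)
open import Data.List.Membership.Propositional using (_∈_)
open import Data.List.Membership.Propositional.Properties using (∈-++⁺ˡ; ∈-++⁺ʳ; ∈-++⁻; ∈-map⁺; ∈-map⁻; ∈-concat⁺′; ∈-concat⁻′; ∈-applyUpTo⁺; ∈-applyUpTo⁻)
open import Data.List.Properties using (length-++; length-map)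
import Data.List.Relation.Unary.All.Properties as All
open import Data.List.Relation.Unary.Any using (here)
open import Data.List.Relation.Unary.All using ([])
open import Data.List.Relation.Unary.AllPairs using ([]; _∷_)
import Data.List.Relation.Unary.AllPairs.Properties as AllPairs
open import Data.List.Relation.Unary.Unique.Propositional using (Unique)
import Data.List.Relation.Unary.Unique.Propositional.Properties as Uniq
open import Data.Product using (∃; _,_; proj₁; proj₂)
open import Data.Sum using (inj₁; inj₂)
open import Data.Unit using (tt)
open import Data.Vec as Vec using (Vec; []; _∷_; lookup; tabulate)
open import Function using (_∘_)
open import Function.Bundles using (_⇔_; mk⇔)
open import Relation.Binary using (tri<; tri≈; tri>)
open import Relation.Binary.PropositionalEquality using (_≡_; refl; sym; trans; cong; cong₂; subst; subst₂; module ≡-Reasoning)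
open import Relation.Nullary using (Dec; yes; no; ¬_)
open import Relation.Nullary.Decidable using (_×-dec_)

-- Finite sums

-- Since d is recovered from r by division, everything is a count of r-vectors, and a triple (r_x,
-- r_y, r₀) enters that count only through its depth K. That there are infinitely many triples
-- causes two difficulties. A list must be finite, so the triples are cut off at a polynomial bound
-- in ℓ beyond which K exceeds ℓ; the upper estimates hold for partial sums of every length and do
-- not see the cutoff. And for fixed u the values of q are unbounded, so a bound on K in terms of u
-- alone cannot be summed. The expansion behind K descends with constant difference p + q; while q /
-- p is small this descent alone is used, and once p + q > p u a second descent with difference p u
-- follows, whose length grows linearly in q / p. The resulting sums over q telescope by the ballot
-- recurrence. The constant is spent as follows: 610 on 2 ≤ u ≤ 39 and 24 on u ≥ 40, both including
-- mirror images, and 10 on p = q = 1; this makes 644, so 702 is met with room to spare.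

∑ : ℕ → (ℕ → ℕ) → ℕ
∑ n f = sum (applyUpTo f n)

∑-mono : ∀ n {f g} → (∀ i → f i ≤ g i) → ∑ n f ≤ ∑ n g
∑-mono zero    f≤g = z≤n
∑-mono (suc n) f≤g = +-mono-≤ (f≤g 0) (∑-mono n (λ i → f≤g (suc i)))

∑-cong : ∀ n {f g} → (∀ i → f i ≡ g i) → ∑ n f ≡ ∑ n g
∑-cong zero    f≡g = refl
∑-cong (suc n) f≡g = cong₂ _+_ (f≡g 0) (∑-cong n (λ i → f≡g (suc i)))

∑-mono-range : ∀ {m n} f → m ≤ n → ∑ m f ≤ ∑ n f
∑-mono-range f z≤n       = z≤n
∑-mono-range f (s≤s m≤n) = +-monoʳ-≤ (f 0) (∑-mono-range (λ i → f (suc i)) m≤n)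

∑-*ˡ : ∀ n c f → ∑ n (λ i → c * f i) ≡ c * ∑ n f
∑-*ˡ zero    c f = sym (*-zeroʳ c)
∑-*ˡ (suc n) c f = trans (cong (c * f 0 +_) (∑-*ˡ n c _)) (sym (*-distribˡ-+ c (f 0) _))

∑-*ʳ : ∀ n c f → ∑ n (λ i → f i * c) ≡ ∑ n f * c
∑-*ʳ n c f = trans (∑-cong n (λ i → *-comm (f i) c)) (trans (∑-*ˡ n c f) (*-comm c _))

∑-const : ∀ n c → ∑ n (λ _ → c) ≡ n * c
∑-const zero    c = refl
∑-const (suc n) c = cong (c +_) (∑-const n c)

∑-split : ∀ m n f → ∑ (m + n) f ≡ ∑ m f + ∑ n (λ i → f (m + i))
∑-split zero    n f = refl
∑-split (suc m) n f = trans (cong (f 0 +_) (∑-split m n _)) (sym (+-assoc (f 0) _ _))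

∑-blocks : ∀ n b f → ∑ (n * b) f ≡ ∑ n (λ i → ∑ b (λ ρ → f (i * b + ρ)))
∑-blocks zero    b f = refl
∑-blocks (suc n) b f = trans (∑-split b (n * b) f)
  (cong (∑ b f +_) (trans (∑-blocks n b _)
    (∑-cong n (λ i → ∑-cong b (λ ρ → cong f (sym (+-assoc b (i * b) ρ)))))))

-- Ballot numbers

-- ballot ℓ K counts the (K + 1)-tuples of binary trees with ℓ − K internal nodes
-- in total, and vanishes for K > ℓ; G is indexed by m = ℓ + 1 − K instead of ℓ.
G : ℕ → ℕ → ℕ
G zero          K       = 0
G (suc m)       (suc K) = G (suc m) K + G m (suc (suc K))
G (suc zero)    zero    = 1
G (suc (suc m)) zero    = G (suc m) 1

ballot : ℕ → ℕ → ℕ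
ballot ℓ K = G (suc ℓ ∸ K) K

G-1 : ∀ K → G 1 K ≡ 1
G-1 zero    = refl
G-1 (suc K) = trans (+-identityʳ _) (G-1 K)

pascal : ∀ n k → suc n C suc k ≡ n C k + n C suc k
pascal n k = sym (nCk+nC[k+1]≡[n+1]C[k+1] n k)

C-middle : ∀ k → suc (k + k) C suc k ≡ suc (k + k) C k
C-middle k = trans (nCk≡nC[n∸k] (s≤s (m≤m+n k k)))
                   (cong (suc (k + k) C_) (m+n∸m≡n k k))

-- The reflection principle: G counts lattice paths that avoid a diagonal.
G-reflect : ∀ m K → G (2 + m) K + (2 + m + m + K) C m ≡ (2 + m + m + K) C suc m
G-reflect zero zero    = refl
G-reflect (suc m) zero = begin
  g + N C suc m                       ≡⟨ cong (g +_) (trans (cong (_C suc m) Neq) (pascal M m)) ⟩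
  g + (M C m + M C suc m)             ≡⟨ sym (+-assoc g _ _) ⟩
  g + M C m + M C suc m               ≡⟨ cong (_+ M C suc m) (trans (cong (λ x → g + x C m) M≡) (trans (G-reflect m 1) (cong (_C suc m) (sym M≡)))) ⟩
  M C suc m + M C suc m               ≡⟨ cong (M C suc m +_) (sym (C-middle (suc m))) ⟩
  M C suc m + M C suc (suc m)         ≡⟨ sym (pascal M (suc m)) ⟩
  suc M C suc (suc m)                 ≡⟨ cong (_C suc (suc m)) (sym Neq) ⟩
  N C suc (suc m)                     ∎
  where
  open ≡-Reasoning
  g N M : ℕ
  g = G (2 + m) 1
  N = 2 + suc m + suc m + 0
  M = suc (suc m + suc m)
  Neq : N ≡ suc M
  Neq = +-identityʳ _
  M≡ : M ≡ 2 + m + m + 1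
  M≡ = lem m
    where
    lem : ∀ m → suc (suc m + suc m) ≡ 2 + m + m + 1
    lem = solve-∀
G-reflect zero (suc K) = begin
  G 2 K + G 1 (2 + K) + N C 0     ≡⟨ cong₂ (λ x y → G 2 K + x + y) (G-1 (2 + K)) (C-zero N) ⟩
  G 2 K + 1 + 1                   ≡⟨ cong (λ x → G 2 K + x + 1) (sym (C-zero (2 + K))) ⟩
  G 2 K + (2 + K) C 0 + 1         ≡⟨ cong₂ _+_ (G-reflect 0 K) (sym (C-zero (2 + K))) ⟩
  (2 + K) C 1 + (2 + K) C 0       ≡⟨ +-comm ((2 + K) C 1) _ ⟩
  (2 + K) C 0 + (2 + K) C 1       ≡⟨ sym (pascal (2 + K) 0) ⟩
  N C 1                           ∎
  where
  open ≡-Reasoning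
  N : ℕ
  N = 2 + 0 + 0 + suc K
  C-zero : ∀ n → n C 0 ≡ 1
  C-zero n = refl
G-reflect (suc m) (suc K) = begin
  g + h + N C suc m                           ≡⟨ cong (g + h +_) (trans (cong (_C suc m) Neq) (pascal M m)) ⟩
  g + h + (M C m + M C suc m)                 ≡⟨ shuffle g h (M C m) (M C suc m) ⟩
  (h + M C m) + (g + M C suc m)               ≡⟨ cong₂ _+_ eq₁ (G-reflect (suc m) K) ⟩
  M C suc m + M C suc (suc m)                 ≡⟨ sym (pascal M (suc m)) ⟩
  suc M C suc (suc m)                         ≡⟨ cong (_C suc (suc m)) (sym Neq) ⟩
  N C suc (suc m)                             ∎
  where
  open ≡-Reasoning
  g h N M : ℕ
  g = G (3 + m) K
  h = G (2 + m) (2 + K)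
  N = 2 + suc m + suc m + suc K
  M = 2 + suc m + suc m + K
  Neq : N ≡ suc M
  Neq = +-suc _ K
  shuffle : ∀ a b c d → a + b + (c + d) ≡ (b + c) + (a + d)
  shuffle = solve-∀
  M≡ : M ≡ 2 + m + m + (2 + K)
  M≡ = lem m K
    where
    lem : ∀ m K → 2 + suc m + suc m + K ≡ 2 + m + m + (2 + K)
    lem = solve-∀
  eq₁ : h + M C m ≡ M C suc m
  eq₁ = trans (cong (λ x → h + x C m) M≡) (trans (G-reflect m (2 + K)) (cong (_C suc m) (sym M≡)))

C-absorb : ∀ k j → suc k * ((k + j) C suc k) ≡ j * ((k + j) C k)
C-absorb k zero = trans (cong (suc k *_) (k>n⇒nCk≡0 (s≤s (≤-reflexive (+-identityʳ k))))) (*-zeroʳ (suc k))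
C-absorb zero (suc j) = trans (*-identityˡ _) (trans (nC1≡n (suc j)) (sym (*-identityʳ (suc j))))
C-absorb (suc k) (suc j) = begin
  (2 + k) * (suc n C suc (suc k))            ≡⟨ cong ((2 + k) *_) (pascal n (suc k)) ⟩
  (2 + k) * (x + y)                          ≡⟨ *-distribˡ-+ (2 + k) x y ⟩
  (2 + k) * x + (2 + k) * y                  ≡⟨ cong ((2 + k) * x +_) eq₁ ⟩
  (2 + k) * x + j * x                        ≡⟨ shuffle k j x ⟩
  suc k * x + suc j * x                      ≡⟨ cong (_+ suc j * x) (C-absorb k (suc j)) ⟩
  suc j * w + suc j * x                      ≡⟨ sym (*-distribˡ-+ (suc j) w x) ⟩
  suc j * (w + x)                            ≡⟨ cong (suc j *_) (sym (pascal n k)) ⟩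
  suc j * (suc n C suc k)                    ∎
  where
  open ≡-Reasoning
  n x y w : ℕ
  n = k + suc j
  x = n C suc k
  y = n C suc (suc k)
  w = n C k
  eq₁ : (2 + k) * y ≡ j * x
  eq₁ = subst (λ z → (2 + k) * (z C suc (suc k)) ≡ j * (z C suc k)) (sym (+-suc k j)) (C-absorb (suc k) j)
  shuffle : ∀ k j x → (2 + k) * x + j * x ≡ suc k * x + suc j * x
  shuffle = solve-∀

-- The closed form at ℓ = m + K with the denominator cleared. Reflection gives `G` as a difference
-- of two binomials; the subtracted one is restored on both sides and traded for the other by
-- absorption.
G-closed : ∀ m K → (suc m + K) * G (suc m) K ≡ suc K * ((m + m + K) C m)
G-closed zero    K = cong (suc K *_) (G-1 K)
G-closed (suc m) K = +-cancelʳ-≡ _ _ _ (begin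
  (2 + m + K) * g + suc m * y               ≡⟨ cong ((2 + m + K) * g +_) absorb ⟩
  (2 + m + K) * g + (2 + m + K) * x         ≡⟨ sym (*-distribˡ-+ (2 + m + K) g x) ⟩
  (2 + m + K) * (g + x)                     ≡⟨ cong ((2 + m + K) *_) (G-reflect m K) ⟩
  (2 + m + K) * y                           ≡⟨ shuffle m K y ⟩
  suc K * y + suc m * y                     ≡⟨ cong (λ z → suc K * (z C suc m) + suc m * y) (N≡ m K) ⟩
  suc K * ((suc m + suc m + K) C suc m) + suc m * y ∎)
  where
  open ≡-Reasoning
  g x y : ℕ
  g = G (2 + m) K
  x = (2 + m + m + K) C m
  y = (2 + m + m + K) C suc m
  N≡ : ∀ m K → 2 + m + m + K ≡ suc m + suc m + K
  N≡ = solve-∀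
  N≡′ : ∀ m K → m + (2 + m + K) ≡ 2 + m + m + K
  N≡′ = solve-∀
  absorb : suc m * y ≡ (2 + m + K) * x
  absorb = subst (λ z → suc m * (z C suc m) ≡ (2 + m + K) * (z C m)) (N≡′ m K) (C-absorb m (2 + m + K))
  shuffle : ∀ m K y → (2 + m + K) * y ≡ suc K * y + suc m * y
  shuffle = solve-∀

catalan≡G : ∀ m → catalan m ≡ G (suc m) 0
catalan≡G m = begin
  ((m + m) C m) / suc m              ≡⟨ cong (_/ suc m) (sym eq) ⟩
  G (suc m) 0 * suc m / suc m        ≡⟨ m*n/n≡m (G (suc m) 0) (suc m) ⟩
  G (suc m) 0                        ∎
  where
  open ≡-Reasoning
  eq : G (suc m) 0 * suc m ≡ (m + m) C m
  eq = begin
    G (suc m) 0 * suc m          ≡⟨ *-comm (G (suc m) 0) (suc m) ⟩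
    suc m * G (suc m) 0          ≡⟨ cong (_* G (suc m) 0) (sym (+-identityʳ (suc m))) ⟩
    (suc m + 0) * G (suc m) 0    ≡⟨ G-closed m 0 ⟩
    1 * ((m + m + 0) C m)        ≡⟨ *-identityˡ _ ⟩
    (m + m + 0) C m              ≡⟨ cong (_C m) (+-identityʳ (m + m)) ⟩
    (m + m) C m                  ∎

-- Off the middle, `G-reflect` exhibits the difference of the two coefficients as a value of `G`.
C-increasing : ∀ m K → (suc (m + m) + K) C m ≤ (suc (m + m) + K) C suc m
C-increasing m zero    = ≤-reflexive (subst (λ z → z C m ≡ z C suc m) (sym (+-identityʳ (suc (m + m)))) (sym (C-middle m)))
C-increasing m (suc K) = subst (λ z → z C m ≤ z C suc m) (sym (+-suc (suc (m + m)) K))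
  (m+n≤o⇒n≤o (G (2 + m) K) (≤-reflexive (G-reflect m K)))

-- At fixed ℓ = suc m + K both closed forms carry the same factor ℓ + 1, so only binomials are
-- compared: Pascal splits the larger one into two terms, and the smaller one is the lesser of
-- these.
G-halving : ∀ m K → 2 * suc K * G (suc m) (suc K) ≤ (2 + K) * G (2 + m) K
G-halving m K = *-cancelˡ-≤ (2 + m + K) (begin
  (2 + m + K) * (2 * suc K * a)              ≡⟨ e₁ (2 + m + K) (suc K) a ⟩
  2 * suc K * ((2 + m + K) * a)              ≡⟨ cong (λ z → 2 * suc K * (suc z * a)) (sym (+-suc m K)) ⟩
  2 * suc K * ((suc m + suc K) * a)          ≡⟨ cong (2 * suc K *_) (G-closed m (suc K)) ⟩
  2 * suc K * ((2 + K) * ((m + m + suc K) C m)) ≡⟨ cong (λ z → 2 * suc K * ((2 + K) * (z C m))) (+-suc (m + m) K) ⟩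
  2 * suc K * ((2 + K) * x)                  ≡⟨ e₂ (suc K) (2 + K) x ⟩
  (2 + K) * (suc K * (x + x))                ≤⟨ *-monoʳ-≤ (2 + K) (*-monoʳ-≤ (suc K) (+-monoʳ-≤ x (C-increasing m K))) ⟩
  (2 + K) * (suc K * (x + y))                ≡⟨ cong (λ z → (2 + K) * (suc K * z)) (sym (pascal (suc (m + m) + K) m)) ⟩
  (2 + K) * (suc K * ((2 + (m + m) + K) C suc m)) ≡⟨ cong (λ z → (2 + K) * (suc K * (z C suc m))) (e₃ m K) ⟩
  (2 + K) * (suc K * ((suc m + suc m + K) C suc m)) ≡⟨ cong ((2 + K) *_) (sym (G-closed (suc m) K)) ⟩
  (2 + K) * ((2 + m + K) * b)                ≡⟨ e₄ (2 + K) (2 + m + K) b ⟩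
  (2 + m + K) * ((2 + K) * b)                ∎)
  where
  open ≤-Reasoning
  a b x y : ℕ
  a = G (suc m) (suc K)
  b = G (2 + m) K
  x = (suc (m + m) + K) C m
  y = (suc (m + m) + K) C suc m
  e₁ : ∀ u v w → u * (2 * v * w) ≡ 2 * v * (u * w)
  e₁ = solve-∀
  e₂ : ∀ u v w → 2 * u * (v * w) ≡ v * (u * (w + w))
  e₂ = solve-∀
  e₃ : ∀ m K → 2 + (m + m) + K ≡ suc m + suc m + K
  e₃ = solve-∀
  e₄ : ∀ u v w → u * (v * w) ≡ v * (u * w)
  e₄ = solve-∀

G-suc : ∀ m K → G m (suc K) ≤ G (suc m) K
G-suc zero          K       = z≤n
G-suc (suc m)       zero    = ≤-refl
G-suc (suc m)       (suc K) = m≤n+m _ (G (2 + m) K)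

ballot-halving : ∀ ℓ K → 2 * suc K * ballot ℓ (suc K) ≤ (2 + K) * ballot ℓ K
ballot-halving ℓ K with <-≤-connex K ℓ
... | inj₂ ℓ≤K rewrite m≤n⇒m∸n≡0 ℓ≤K | *-zeroʳ (2 * suc K) = z≤n
... | inj₁ K<ℓ = subst₂ (λ a b → 2 * suc K * G a (suc K) ≤ (2 + K) * G b K)
        (trans (sym (+-∸-assoc 1 K<ℓ)) refl)
        (trans (cong suc (sym (+-∸-assoc 1 K<ℓ))) (sym (+-∸-assoc 1 (<⇒≤ K<ℓ))))
        (G-halving (ℓ ∸ suc K) K)

ballot-decreasing-suc : ∀ ℓ K → ballot ℓ (suc K) ≤ ballot ℓ K
ballot-decreasing-suc ℓ K with ≤-<-connex K ℓ
... | inj₁ K≤ℓ = subst (λ a → G (ℓ ∸ K) (suc K) ≤ G a K) (sym (+-∸-assoc 1 K≤ℓ)) (G-suc (ℓ ∸ K) K)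
... | inj₂ ℓ<K rewrite m≤n⇒m∸n≡0 (<⇒≤ ℓ<K) = z≤n

ballot-decreasing : ∀ ℓ {J K} → J ≤ K → ballot ℓ K ≤ ballot ℓ J
ballot-decreasing ℓ {J} {K} J≤K = go (≤⇒≤′ J≤K)
  where
  go : ∀ {K} → J ≤′ K → ballot ℓ K ≤ ballot ℓ J
  go ≤′-refl      = ≤-refl
  go {suc K} (≤′-step J≤) = ≤-trans (ballot-decreasing-suc ℓ K) (go J≤)

ballot-zero : ∀ ℓ → ballot ℓ 0 ≡ catalan ℓ
ballot-zero ℓ = sym (catalan≡G ℓ)

ballot-one : ∀ ℓ → ballot (suc ℓ) 1 ≡ catalan (suc ℓ)
ballot-one ℓ = sym (catalan≡G (suc ℓ))

ballot-decay : ∀ ℓ K → 2 ^ K * ballot ℓ K ≤ suc K * catalan ℓ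
ballot-decay ℓ zero    = ≤-reflexive (cong (1 *_) (ballot-zero ℓ))
ballot-decay ℓ (suc K) = *-cancelˡ-≤ (suc K) (begin
  suc K * (2 ^ suc K * b′)       ≡⟨ e₁ (suc K) (2 ^ K) b′ ⟩
  2 ^ K * (2 * suc K * b′)       ≤⟨ *-monoʳ-≤ (2 ^ K) (ballot-halving ℓ K) ⟩
  2 ^ K * ((2 + K) * b)          ≡⟨ e₂ (2 ^ K) (2 + K) b ⟩
  (2 + K) * (2 ^ K * b)          ≤⟨ *-monoʳ-≤ (2 + K) (ballot-decay ℓ K) ⟩
  (2 + K) * (suc K * catalan ℓ)  ≡⟨ e₂ (2 + K) (suc K) (catalan ℓ) ⟩
  suc K * ((2 + K) * catalan ℓ)  ∎)
  where
  open ≤-Reasoning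
  b b′ : ℕ
  b = ballot ℓ K
  b′ = ballot ℓ (suc K)
  e₁ : ∀ u v w → u * (2 * v * w) ≡ v * (2 * u * w)
  e₁ = solve-∀
  e₂ : ∀ u v w → u * (v * w) ≡ v * (u * w)
  e₂ = solve-∀

ballot-recurrence : ∀ ℓ K → ballot (suc ℓ) (suc K) ≡ ballot ℓ K + ballot (suc ℓ) (2 + K)
ballot-recurrence ℓ K with ≤-<-connex K ℓ
... | inj₁ K≤ℓ rewrite +-∸-assoc 1 K≤ℓ = refl
... | inj₂ ℓ<K rewrite m≤n⇒m∸n≡0 ℓ<K | m≤n⇒m∸n≡0 (<⇒≤ ℓ<K) = refl

-- By the recurrence each summand is a difference of neighbours in row `suc ℓ`, so the sum
-- telescopes. Keeping the remainder on the left gives both the exact row sum and bounds independent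
-- of `n`.
∑-ballot-tail : ∀ n ℓ K → ∑ n (λ i → ballot ℓ (K + i)) + ballot (suc ℓ) (suc (K + n)) ≡ ballot (suc ℓ) (suc K)
∑-ballot-tail zero    ℓ K = cong (λ z → ballot (suc ℓ) (suc z)) (+-identityʳ K)
∑-ballot-tail (suc n) ℓ K = begin
  ballot ℓ (K + 0) + S + ballot (suc ℓ) (suc (K + suc n))     ≡⟨ +-assoc (ballot ℓ (K + 0)) S _ ⟩
  ballot ℓ (K + 0) + (S + ballot (suc ℓ) (suc (K + suc n)))   ≡⟨ cong₂ (λ a b → ballot ℓ a + b) (+-identityʳ K) eq ⟩
  ballot ℓ K + ballot (suc ℓ) (2 + K)                         ≡⟨ sym (ballot-recurrence ℓ K) ⟩
  ballot (suc ℓ) (suc K)                                      ∎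
  where
  open ≡-Reasoning
  S : ℕ
  S = ∑ n (λ i → ballot ℓ (K + suc i))
  eq : S + ballot (suc ℓ) (suc (K + suc n)) ≡ ballot (suc ℓ) (2 + K)
  eq = trans (cong₂ (λ a b → a + ballot (suc ℓ) (suc b))
                (∑-cong n (λ i → cong (ballot ℓ) (+-suc K i))) (+-suc K n))
             (∑-ballot-tail n ℓ (suc K))

∑-ballot-≤ : ∀ n ℓ K → ∑ n (λ i → ballot ℓ (K + i)) ≤ ballot (suc ℓ) (suc K)
∑-ballot-≤ n ℓ K = m+n≤o⇒m≤o _ (≤-reflexive (∑-ballot-tail n ℓ K))

∑-ballot : ∀ n ℓ → ℓ < n → ∑ n (ballot ℓ) ≡ catalan (suc ℓ)
∑-ballot n ℓ ℓ<n = begin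
  ∑ n (ballot ℓ)                                      ≡⟨ sym (+-identityʳ _) ⟩
  ∑ n (ballot ℓ) + 0                                  ≡⟨ cong (∑ n (ballot ℓ) +_) (sym vanish) ⟩
  ∑ n (ballot ℓ) + ballot (suc ℓ) (suc n)             ≡⟨ ∑-ballot-tail n ℓ 0 ⟩
  ballot (suc ℓ) 1                                    ≡⟨ ballot-one ℓ ⟩
  catalan (suc ℓ)                                     ∎
  where
  open ≡-Reasoning
  vanish : ballot (suc ℓ) (suc n) ≡ 0
  vanish = cong (λ z → G z (suc n)) (m≤n⇒m∸n≡0 ℓ<n)

catalan-suc-≤ : ∀ ℓ → catalan (suc ℓ) ≤ 4 * catalan ℓ
catalan-suc-≤ ℓ = *-cancelˡ-≤ (2 + ℓ) (begin
  (2 + ℓ) * catalan (suc ℓ)               ≡⟨ cong₂ (λ a b → suc a * b) (+-comm 1 ℓ) (catalan≡G (suc ℓ)) ⟩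
  (suc ℓ + 1) * G (suc ℓ) 1               ≡⟨ G-closed ℓ 1 ⟩
  2 * ((ℓ + ℓ + 1) C ℓ)                   ≤⟨ *-monoʳ-≤ 2 (central ℓ) ⟩
  2 * (2 * ((ℓ + ℓ + 0) C ℓ))             ≡⟨ e₁ ((ℓ + ℓ + 0) C ℓ) ⟩
  4 * (1 * ((ℓ + ℓ + 0) C ℓ))             ≡⟨ cong (4 *_) (sym (G-closed ℓ 0)) ⟩
  4 * ((suc ℓ + 0) * G (suc ℓ) 0)         ≡⟨ cong₂ (λ a b → 4 * (a * b)) (+-identityʳ (suc ℓ)) (sym (catalan≡G ℓ)) ⟩
  4 * (suc ℓ * catalan ℓ)                 ≤⟨ *-monoʳ-≤ 4 (*-monoˡ-≤ (catalan ℓ) (n≤1+n (suc ℓ))) ⟩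
  4 * ((2 + ℓ) * catalan ℓ)               ≡⟨ e₂ (2 + ℓ) (catalan ℓ) ⟩
  (2 + ℓ) * (4 * catalan ℓ)               ∎)
  where
  open ≤-Reasoning
  e₁ : ∀ u → 2 * (2 * u) ≡ 4 * (1 * u)
  e₁ = solve-∀
  e₂ : ∀ u v → 4 * (u * v) ≡ u * (4 * v)
  e₂ = solve-∀
  e₃ : ∀ k → suc k + suc k + 0 ≡ 2 + k + k + 0
  e₃ = solve-∀
  central : ∀ ℓ → (ℓ + ℓ + 1) C ℓ ≤ 2 * ((ℓ + ℓ + 0) C ℓ)
  central zero    = s≤s z≤n
  central (suc k) = begin
    (suc k + suc k + 1) C suc k       ≡⟨ cong (_C suc k) (trans (+-suc (suc k + suc k) 0) (cong suc (e₃ k))) ⟩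
    suc N C suc k                     ≡⟨ pascal N k ⟩
    N C k + N C suc k                 ≤⟨ +-monoˡ-≤ (N C suc k) (subst (N C k ≤_) (G-reflect k 0) (m≤n+m _ (G (2 + k) 0))) ⟩
    N C suc k + N C suc k             ≡⟨ cong (N C suc k +_) (sym (+-identityʳ _)) ⟩
    2 * (N C suc k)                   ≡⟨ cong (λ z → 2 * (z C suc k)) (sym (e₃ k)) ⟩
    2 * ((suc k + suc k + 0) C suc k) ∎
    where
    N : ℕ
    N = 2 + k + k + 0

-- Tails and negative continued fractions

-- The entry following a vertex; it is 0 beyond the end of the tail.
hd : ∀ {n} → Vec ℕ n → ℕ
hd []      = 0
hd (b ∷ _) = b

-- r₁, …, r_ℓ satisfies the equations at v₁, …, v_ℓ when r₀ = a.
data Tail (a : ℕ) : ∀ {ℓ} → Vec ℕ ℓ → Set where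
  []  : Tail a []
  _∷_ : ∀ {ℓ b} {rs : Vec ℕ ℓ} → 0 < b × b ∣ a + hd rs → Tail b rs → Tail a (b ∷ rs)

-- K is the length of a negative continued fraction a / b = d₁ − 1 / (d₂ − …);
-- b′ < b makes all partial quotients except possibly the first at least 2.
data Depth : ℕ → ℕ → ℕ → Set where
  stop : ∀ {a} → Depth a 0 0
  step : ∀ {a b b′ K} → b′ < b → b ∣ a + b′ → Depth b b′ K → Depth a b (suc K)

residue-unique : ∀ a {b b′ x} → b′ < b → b ∣ a + b′ → b ∣ a + x → ∃ λ j → x ≡ b′ + j * b
residue-unique a {b} {b′} {x} b′<b b∣ b∣x with ≤-<-connex b′ x
... | inj₁ b′≤x with ∣m+n∣m⇒∣n (subst (b ∣_) eq b∣x) b∣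
  where
  eq : a + x ≡ a + b′ + (x ∸ b′)
  eq = trans (cong (a +_) (sym (m+[n∸m]≡n b′≤x))) (sym (+-assoc a b′ _))
... | divides j eq′ = j , trans (sym (m+[n∸m]≡n b′≤x)) (cong (b′ +_) eq′)
residue-unique a {b} {b′} {x} b′<b b∣ b∣x | inj₂ x<b′ =
  ⊥-elim (<⇒≱ (≤-<-trans (m∸n≤m b′ x) b′<b) (∣⇒≤ ⦃ >-nonZero (m<n⇒0<n∸m x<b′) ⦄ (∣m+n∣m⇒∣n (subst (b ∣_) eq b∣) b∣x)))
  where
  eq : a + b′ ≡ a + x + (b′ ∸ x)
  eq = trans (cong (a +_) (sym (m+[n∸m]≡n (<⇒≤ x<b′)))) (sym (+-assoc a x _))

depth-unique : ∀ {a b K K′} → Depth a b K → Depth a b K′ → K ≡ K′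
depth-unique stop stop = refl
depth-unique {a} {b} (step {b′ = x} x<b b∣x D) (step {b′ = y} y<b b∣y D′) =
  cong suc (depth-unique D (subst (λ z → Depth b z _) (sym x≡y) D′))
  where
  x≡y : x ≡ y
  x≡y with residue-unique a x<b b∣x b∣y
  ... | zero  , eq = sym (trans eq (+-identityʳ x))
  ... | suc j , eq = ⊥-elim (<⇒≱ y<b (≤-trans (≤-trans (m≤m+n b (j * b)) (m≤n+m _ x)) (≤-reflexive (sym eq))))

neg-mod : ∀ a b → ∃ λ b′ → b′ < suc b × suc b ∣ a + b′
neg-mod a b = b ∸ r , s≤s (m∸n≤m b r) , divides ((a + b) / suc b) (begin
  a + (b ∸ r)                   ≡⟨ sym (+-∸-assoc a r≤b) ⟩
  a + b ∸ r                     ≡⟨ cong (_∸ r) (m≡m%n+[m/n]*n (a + b) (suc b)) ⟩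
  r + (a + b) / suc b * suc b ∸ r ≡⟨ m+n∸m≡n r _ ⟩
  (a + b) / suc b * suc b       ∎)
  where
  open ≡-Reasoning
  r : ℕ
  r = (a + b) % suc b
  r≤b : r ≤ b
  r≤b = s≤s⁻¹ (m%n<n (a + b) (suc b))

abstract
  depth : ∀ a b → ∃ (Depth a b)
  depth a b = <-rec (λ b → ∀ a → ∃ (Depth a b)) go b a
    where
    go : ∀ b → (∀ {b′} → b′ < b → ∀ a → ∃ (Depth a b′)) → ∀ a → ∃ (Depth a b)
    go zero    rec a = 0 , stop
    go (suc b) rec a with neg-mod a b
    ... | b′ , b′<b , b∣ with rec b′<b (suc b)
    ... | K , D = suc K , step b′<b b∣ D

-- Replacing r₁ by r₀ + r₁ blows up the edge v₀v₁.
shift : ∀ {a b K} → 0 < a → Depth a b K → Depth a (b + a) (suc K)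
shift {a} 0<a stop = step 0<a (subst (a ∣_) (sym (+-identityʳ a)) ∣-refl) stop
shift {a} {b} 0<a (step {b′ = b′} b′<b b∣ D) =
  step (m<m+n b 0<a) (subst (b + a ∣_) (+-comm b a) ∣-refl)
    (step b′<b (subst (b ∣_) (sym (+-assoc b a b′)) (∣m∣n⇒∣m+n ∣-refl b∣)) D)

shift* : ∀ {a b K} → 0 < a → ∀ j → Depth a b K → Depth a (b + j * a) (j + K)
shift* {a} {b} 0<a zero    D = subst (λ z → Depth a z _) (sym (+-identityʳ b)) D
shift* {a} {b} {K} 0<a (suc j) D =
  subst (λ z → Depth a z (suc (j + K))) (trans (+-assoc b (j * a) a) (cong (b +_) (+-comm (j * a) a)))
    (shift 0<a (shift* 0<a j D))

-- The greedy expansion is the shortest tail: any other choice of the next entry exceeds the least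
-- residue by j multiples of b, and by `shift*` this costs j further steps.
tail-length : ∀ {a ℓ K} {rs : Vec ℕ ℓ} → Tail a rs → Depth a (hd rs) K → K ≤ ℓ
tail-length []                    stop            = z≤n
tail-length {a} ((0<b , b∣) ∷ T) (step b′<b b∣′ D) with residue-unique a b′<b b∣′ b∣
... | j , eq = s≤s (≤-trans (m≤n+m _ j) (tail-length T (subst (λ z → Depth _ z _) (sym eq) (shift* 0<b j D))))
tail-length ((() , _) ∷ T) stop

-- Listing all tails of a given length

mutual
  -- The tails of length ℓ whose first entry is congruent to b modulo a and at
  -- least b, provided that ℓ < m + K.
  tails : ∀ {a b K} → ℕ → ∀ ℓ → 0 < a → Depth a b K → List (Vec ℕ ℓ)
  tails zero    ℓ 0<a D = []
  tails (suc m) ℓ 0<a D = tails₌ (suc m) ℓ D ++ tails m ℓ 0<a (shift 0<a D)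

  tails₌ : ∀ {a b K} → ℕ → ∀ ℓ → Depth a b K → List (Vec ℕ ℓ)
  tails₌ m zero    stop                = [] ∷ []
  tails₌ m (suc ℓ) stop                = []
  tails₌ m zero    (step _ _ _)        = []
  tails₌ m (suc ℓ) (step {b = b} b′<b _ D) = map (b ∷_) (tails m ℓ (m<n⇒0<n b′<b) D)

-- The list follows the recursion of `G`: keeping the first entry b leaves a shorter tail of depth
-- one less, while replacing it by b + a raises the depth by one and uses up one unit of `m`.
length-tails : ∀ {a b K} m ℓ (0<a : 0 < a) (D : Depth a b K) → m + K ≡ suc ℓ → length (tails m ℓ 0<a D) ≡ G m K
length-tails zero    ℓ 0<a D eq = refl
length-tails (suc zero)    zero    0<a stop eq = refl
length-tails (suc (suc m)) zero    0<a stop ()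
length-tails (suc zero)    (suc ℓ) 0<a stop ()
length-tails (suc (suc m)) (suc ℓ) 0<a stop eq =
  length-tails (suc m) (suc ℓ) 0<a (shift 0<a stop) (trans (+-suc (suc m) 0) eq)
length-tails (suc m) zero 0<a (step {K = K} _ _ D) eq with () ← trans (sym (+-suc m K)) (suc-injective eq)
length-tails (suc m) (suc ℓ) 0<a D₀@(step {b = b} {K = K} b′<b _ D) eq = begin
  length (map (b ∷_) ts ++ us)          ≡⟨ length-++ (map (b ∷_) ts) ⟩
  length (map (b ∷_) ts) + length us    ≡⟨ cong₂ _+_ (trans (length-map (b ∷_) ts) (length-tails (suc m) ℓ _ D (trans (sym (+-suc m K)) (suc-injective eq))))
                                                     (length-tails m (suc ℓ) 0<a (shift 0<a D₀) (trans (+-suc m (suc K)) eq)) ⟩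
  G (suc m) K + G m (2 + K)             ∎
  where
  open ≡-Reasoning
  ts = tails (suc m) ℓ (m<n⇒0<n b′<b) D
  us = tails m (suc ℓ) 0<a (shift 0<a D₀)

mutual
  tails-sound : ∀ {a b K} m ℓ (0<a : 0 < a) (D : Depth a b K) {rs} → rs ∈ tails m ℓ 0<a D →
                Tail a rs × ∃ λ j → hd rs ≡ b + j * a
  tails-sound {a} {b} (suc m) ℓ 0<a D rs∈ with ∈-++⁻ (tails₌ (suc m) ℓ D) rs∈
  ... | inj₁ ∈₁ with tails₌-sound (suc m) ℓ D ∈₁
  ...   | T , eq = T , 0 , trans eq (sym (+-identityʳ b))
  tails-sound {a} {b} (suc m) ℓ 0<a D rs∈ | inj₂ ∈₂ with tails-sound m ℓ 0<a (shift 0<a D) ∈₂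
  ...   | T , j , eq = T , suc j , trans eq (+-assoc b a (j * a))

  tails₌-sound : ∀ {a b K} m ℓ (D : Depth a b K) {rs} → rs ∈ tails₌ m ℓ D → Tail a rs × hd rs ≡ b
  tails₌-sound m zero stop (here refl) = [] , refl
  tails₌-sound {a} m (suc ℓ) (step {b = b} {b′ = b′} b′<b b∣ D) rs∈ with ∈-map⁻ (b ∷_) rs∈
  ... | rs , rs∈′ , refl with tails-sound m ℓ (m<n⇒0<n b′<b) D rs∈′
  ...   | T , j , eq = (m<n⇒0<n b′<b , subst (b ∣_) lem (∣m∣n⇒∣m+n b∣ (n∣m*n j))) ∷ T , refl
    where
    lem : a + b′ + j * b ≡ a + hd rs
    lem = trans (+-assoc a b′ _) (cong (a +_) (sym eq))

mutual
  tails-complete : ∀ {a b K} m ℓ (0<a : 0 < a) (D : Depth a b K) {rs} → suc ℓ ≤ m + K →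
                   Tail a rs → ∀ j → hd rs ≡ b + j * a → rs ∈ tails m ℓ 0<a D
  -- No shift is left, and by `tail-length` none is wanted: already the least first entry has depth
  -- above ℓ.
  tails-complete zero ℓ 0<a D ℓ<K T j eq =
    ⊥-elim (<⇒≱ ℓ<K (≤-trans (m≤n+m _ j) (tail-length T (subst (λ z → Depth _ z _) (sym eq) (shift* 0<a j D)))))
  tails-complete {b = b} (suc m) ℓ 0<a D ℓ<K T zero    eq =
    ∈-++⁺ˡ (tails₌-complete (suc m) ℓ D ℓ<K T (trans eq (+-identityʳ b)))
  tails-complete {a} {b} (suc m) ℓ 0<a D ℓ<K T (suc j) eq =
    ∈-++⁺ʳ (tails₌ (suc m) ℓ D) (tails-complete m ℓ 0<a (shift 0<a D) (subst (suc ℓ ≤_) (sym (+-suc m _)) ℓ<K)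
      T j (trans eq (sym (+-assoc b a (j * a)))))

  tails₌-complete : ∀ {a b K} m ℓ (D : Depth a b K) {rs} → suc ℓ ≤ m + K → Tail a rs → hd rs ≡ b → rs ∈ tails₌ m ℓ D
  tails₌-complete m zero    stop            ℓ<K []             eq = here refl
  tails₌-complete m zero    (step () _ D)   ℓ<K []             refl
  tails₌-complete m (suc ℓ) stop            ℓ<K ((() , _) ∷ T) refl
  tails₌-complete {a} m (suc ℓ) (step {K = K} b′<b b∣ D) ℓ<K ((0<b , b∣′) ∷ T) refl
    with residue-unique a b′<b b∣ b∣′
  ... | j , eq = ∈-map⁺ _ (tails-complete m ℓ _ D (s≤s⁻¹ (subst (2 + ℓ ≤_) (+-suc m K) ℓ<K)) T j eq)

mutual
  tails-unique : ∀ {a b K} m ℓ (0<a : 0 < a) (D : Depth a b K) → Unique (tails m ℓ 0<a D)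
  tails-unique zero    ℓ 0<a D = []
  tails-unique {a} {b} (suc m) ℓ 0<a D = Uniq.++⁺ (tails₌-unique (suc m) ℓ D) (tails-unique m ℓ 0<a (shift 0<a D)) disjoint
    where
    disjoint : ∀ {rs} → (rs ∈ tails₌ (suc m) ℓ D) × (rs ∈ tails m ℓ 0<a (shift 0<a D)) → _
    disjoint (∈₁ , ∈₂) with tails₌-sound (suc m) ℓ D ∈₁ | tails-sound m ℓ 0<a (shift 0<a D) ∈₂
    ... | _ , eq | _ , j , eq′ =
      <⇒≢ (≤-trans (m<m+n b 0<a) (m≤m+n (b + a) (j * a))) (trans (sym eq) eq′)

  tails₌-unique : ∀ {a b K} m ℓ (D : Depth a b K) → Unique (tails₌ m ℓ D)
  tails₌-unique m zero    stop         = [] ∷ []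
  tails₌-unique m (suc ℓ) stop         = []
  tails₌-unique m zero    (step _ _ _) = []
  tails₌-unique m (suc ℓ) (step b′<b _ D) = Uniq.map⁺ ∷-inj (tails-unique m ℓ _ D)
    where
    ∷-inj : ∀ {b : ℕ} {n} {xs ys : Vec ℕ n} → b Vec.∷ xs ≡ b Vec.∷ ys → xs ≡ ys
    ∷-inj refl = refl

-- Lower bounds for the depth

-- A partial quotient 2 means that three successive entries are in arithmetic progression, here y +
-- 2s, y + s, y.
complement-step : ∀ {y s K} → 0 < s → Depth (y + s) y K → Depth (y + s + s) (y + s) (suc K)
complement-step {y} {s} 0<s D = step (m<m+n y 0<s) (divides 2 (lem y s)) D
  where
  lem : ∀ y s → y + s + s + y ≡ 2 * (y + s)
  lem = solve-∀

-- A first partial quotient 1. With s = p + q and x + s = r₀ it moves the problem to the pair (x +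
-- s, x), where the descent by s starts.
depth-complement : ∀ {x s K} → 0 < s → Depth (x + s) x K → Depth s (x + s) (suc K)
depth-complement {x} {s} 0<s D = step (m<m+n x 0<s) (subst (x + s ∣_) (+-comm x s) ∣-refl) D

-- Runs `complement-step` backwards, which is possible because the expansion is deterministic.
depth-predecessor : ∀ {y s K} → 0 < s → Depth (y + s + s) (y + s) K → ∃ λ K′ → K ≡ suc K′ × Depth (y + s) y K′
depth-predecessor {y} {s} 0<s D with depth (y + s) y
... | K′ , D′ = K′ , depth-unique D (complement-step 0<s D′) , D′

-- As long as the smaller entry of the pair is at least s, the expansion subtracts s once more with
-- partial quotient 2, so its length is at least the number of such subtractions.
depth-≥ : ∀ {x s K} j → 0 < s → j * s < x + s → Depth (x + s) x K → j ≤ K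
depth-≥ zero 0<s j< D = z≤n
depth-≥ {x} {s} (suc zero) 0<s j< (step _ _ _) = s≤s z≤n
depth-≥ {x} {s} (suc zero) 0<s j< stop with () ← <-irrefl (*-identityˡ s) j<
depth-≥ {x} {s} {K} (suc (suc j)) 0<s j< D = go (m∸n+n≡m s≤x)
  where
  sj<x : suc j * s < x
  sj<x = +-cancelʳ-< s (suc j * s) x (subst (_< x + s) (+-comm s (suc j * s)) j<)
  s≤x : s ≤ x
  s≤x = ≤-trans (m≤m+n s (j * s)) (<⇒≤ sj<x)
  go : ∀ {y} → y + s ≡ x → suc (suc j) ≤ K
  go refl with depth-predecessor 0<s D
  ... | K′ , refl , D′ = s≤s (depth-≥ (suc j) 0<s sj<x D′)

-- Two progressions in a row. After `w` subtractions of s the pair is (z + s, z). Only the residue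
-- of its first entry modulo z matters, so that entry may be replaced by s = z + P, and a
-- progression with difference P begins.
depth-≥-two-terms : ∀ {z P K} w j → 0 < P → j * P < z + P → 0 < z →
                    let s = z + P in Depth (z + w * s + s) (z + w * s) K → w + j ≤ K
depth-≥-two-terms {z} {P} {K} zero j 0<P j< 0<z D =
  depth-≥ j 0<P j< (reduce (subst (λ y → Depth (y + (z + P)) y K) (+-identityʳ z) D))
  where
  reduce : ∀ {K} → Depth (z + (z + P)) z K → Depth (z + P) z K
  reduce stop = stop
  reduce (step {b′ = b′} b′<z z∣ D) = step b′<z (∣m+n∣m⇒∣n (subst (z ∣_) (+-assoc z (z + P) b′) z∣) ∣-refl) D
depth-≥-two-terms {z} {P} {K} (suc w) j 0<P j< 0<z D
  with depth-predecessor {z + w * (z + P)} {z + P} (≤-trans 0<z (m≤m+n z P)) (subst (λ y → Depth (y + (z + P)) y K) (lem z w (z + P)) D)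
  where
  lem : ∀ z w s → z + suc w * s ≡ z + w * s + s
  lem = solve-∀
... | K′ , refl , D′ = s≤s (depth-≥-two-terms w j 0<P j< 0<z D′)

-- Lower bounds for the depth K attached to r_x = p < q = r_y and r₀ = u q, where
-- u = w + 2: bound w i applies if p (i + 2) < p + q, and bound′ w i applies if
-- p i < p + q and u ≤ i.
bound : ℕ → ℕ → ℕ
bound w i = suc w ∸ suc w / suc (suc i)

bound′ : ℕ → ℕ → ℕ
bound′ w i = w + i / suc (suc w)

module _ (p δ w : ℕ) {K : ℕ} (0<p : 0 < p) (D : Depth (p + (p + suc δ)) ((2 + w) * (p + suc δ)) (suc K)) where

  private
    q s u x : ℕ
    q = p + suc δ
    s = p + q
    u = 2 + w
    x = w * q + suc δ

    0<s : 0 < s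
    0<s = ≤-trans 0<p (m≤m+n p q)

    uq≡ : u * q ≡ x + s
    uq≡ = lem p (suc δ) w
      where
      lem : ∀ p d w → (2 + w) * (p + d) ≡ w * (p + d) + d + (p + (p + d))
      lem = solve-∀

    D′ : Depth (x + s) x K
    D′ with depth (x + s) x
    ... | K′ , D″ = subst (Depth (x + s) x) (suc-injective (depth-unique (depth-complement 0<s D″) (subst (λ c → Depth s c (suc K)) uq≡ D))) D″

  depth-bound : ∀ i → p * (2 + i) < s → bound w i ≤ K
  -- Here `suc e` is u / (i + 2) rounded up, so p u < suc e * s, and f = u - suc e. Since u q = u s
  -- - p u, it follows that f s < u q.
  depth-bound i pi<s = depth-≥ f 0<s (+-cancelʳ-< (p * u) (f * s) (x + s) (begin-strict
    f * s + p * u            ≤⟨ +-monoʳ-≤ (f * s) pu≤ ⟩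
    f * s + suc e * (p * (2 + i)) <⟨ +-monoʳ-< (f * s) (*-monoʳ-< (suc e) pi<s) ⟩
    f * s + suc e * s        ≡⟨ sym (*-distribʳ-+ s f (suc e)) ⟩
    (f + suc e) * s          ≡⟨ cong (_* s) (trans (+-suc f e) (cong suc (m∸n+n≡m e≤))) ⟩
    u * s                    ≡⟨ lem p q u ⟩
    u * q + p * u            ≡⟨ cong (_+ p * u) uq≡ ⟩
    x + s + p * u            ∎)) D′
    where
    open ≤-Reasoning
    e f : ℕ
    e = suc w / (2 + i)
    f = bound w i
    e≤ : e ≤ suc w
    e≤ = m/n≤m (suc w) (2 + i)
    u≤ : u ≤ suc e * (2 + i)
    u≤ = begin
      suc (suc w)                               ≡⟨ cong suc (m≡m%n+[m/n]*n (suc w) (2 + i)) ⟩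
      suc (suc w % (2 + i)) + e * (2 + i)       ≤⟨ +-monoˡ-≤ (e * (2 + i)) (m%n<n (suc w) (2 + i)) ⟩
      suc e * (2 + i)                           ∎
    pu≤ : p * u ≤ suc e * (p * (2 + i))
    pu≤ = ≤-trans (*-monoʳ-≤ p u≤) (≤-reflexive (lem′ p (suc e) (2 + i)))
      where
      lem′ : ∀ a b c → a * (b * c) ≡ b * (a * c)
      lem′ = solve-∀
    lem : ∀ p q u → u * (p + q) ≡ u * q + p * u
    lem = solve-∀

  -- With z = s - p u one has u q = z + w s + s, so after the `w` steps of difference s there is a
  -- second descent of difference P = p u. As p i < s, it has at least i / u steps.
  depth-bound′ : ∀ i → u ≤ i → p * i < s → bound′ w i ≤ K
  depth-bound′ i u≤i pi<s = depth-≥-two-terms w j 0<P jP< (m<n⇒0<n∸m P<s) D″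
    where
    open ≤-Reasoning
    P z j : ℕ
    P = p * u
    z = s ∸ P
    j = i / u
    P<s : P < s
    P<s = ≤-<-trans (*-monoʳ-≤ p u≤i) pi<s
    0<P : 0 < P
    0<P = ≤-trans 0<p (m≤m*n p u)
    z+P≡s : z + P ≡ s
    z+P≡s = m∸n+n≡m (<⇒≤ P<s)
    jP< : j * P < z + P
    jP< = begin-strict
      j * (p * u)    ≡⟨ lem j p u ⟩
      p * (j * u)    ≤⟨ *-monoʳ-≤ p (m/n*n≤m i u) ⟩
      p * i          <⟨ pi<s ⟩
      s              ≡⟨ sym z+P≡s ⟩
      z + P          ∎
      where
      lem : ∀ a b c → a * (b * c) ≡ b * (a * c)
      lem = solve-∀
    x≡ : z + w * (z + P) ≡ x
    x≡ = +-cancelʳ-≡ P _ _ (begin-equality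
      z + w * (z + P) + P         ≡⟨ lem z P (w * (z + P)) ⟩
      w * (z + P) + (z + P)       ≡⟨ cong (λ y → w * y + y) z+P≡s ⟩
      w * s + s                   ≡⟨ lem′ p (suc δ) w ⟩
      x + P                       ∎)
      where
      lem : ∀ a b c → a + c + b ≡ c + (a + b)
      lem = solve-∀
      lem′ : ∀ p d w → w * (p + (p + d)) + (p + (p + d)) ≡ w * (p + d) + d + p * (2 + w)
      lem′ = solve-∀
    D″ : Depth (z + w * (z + P) + (z + P)) (z + w * (z + P)) K
    D″ = subst₂ (λ a b → Depth (a + b) a K) (sym x≡) (sym z+P≡s) D′

-- All partial quotients are 2: the entries are the consecutive integers down to 0.
depth-q-1 : ∀ q → Depth (1 + suc q) (1 * suc q) (suc q)
depth-q-1 q = step (≤-reflexive (sym (*-identityˡ (suc q)))) (divides 2 (lem q))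
  (subst (λ c → Depth c q q) (sym (trans (*-identityˡ (suc q)) (+-comm 1 q))) (go q))
  where
  lem : ∀ q → 1 + suc q + q ≡ 2 * (1 * suc q)
  lem = solve-∀
  go : ∀ y → Depth (y + 1) y y
  go zero    = stop
  go (suc y) = subst (λ c → Depth (c + 1) c (suc y)) (+-comm y 1) (complement-step (s≤s z≤n) (go y))

depth-1-1-≥ : ∀ k {K} → Depth 2 (3 + k) (suc K) → suc (k / 2) ≤ K
depth-1-1-≥ k {K} D with depth (suc k + 2) (suc k)
... | K′ , D′ = subst (suc (k / 2) ≤_)
    (suc-injective (depth-unique (depth-complement (s≤s z≤n) D′)
      (subst (λ c → Depth 2 c (suc K)) (cong suc (+-comm 2 k)) D)))
    (depth-≥ (suc (k / 2)) (s≤s z≤n) (begin-strict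
      2 + k / 2 * 2   ≤⟨ +-monoʳ-≤ 2 (m/n*n≤m k 2) ⟩
      2 + k           <⟨ n<1+n (2 + k) ⟩
      3 + k           ≡⟨ cong suc (+-comm 2 k) ⟩
      suc k + 2       ∎) D′)
  where open ≤-Reasoning

-- Arithmetical structures on the bident

infixl 7 _÷_

-- The default value 0 makes `dVector` a function on all vectors, so the structures can be listed as
-- the image of the list of r-vectors.
_÷_ : ℕ → ℕ → ℕ
m ÷ zero  = 0
m ÷ suc n = m / suc n

÷-exact : ∀ {m n} → 0 < n → n ∣ m → m ÷ n * n ≡ m
÷-exact {n = suc n} _ n∣m = m/n*n≡m n∣m

÷-unique : ∀ {d m n} → 0 < n → d * n ≡ m → d ≡ m ÷ n
÷-unique {d} {n = suc n} _ refl = sym (m*n/n≡m d (suc n))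

factor-positive : ∀ {d n m} → 0 < m → d * n ≡ m → 0 < d
factor-positive {zero}  0<m refl = 0<m
factor-positive {suc d} _   _    = s≤s z≤n

dTail : ∀ {ℓ} → ℕ → Vec ℕ ℓ → Vec ℕ ℓ
dTail a []       = []
dTail a (b ∷ rs) = (a + hd rs) ÷ b ∷ dTail b rs

dVector : ∀ {ℓ} → Vec ℕ (3 + ℓ) → Vec ℕ (3 + ℓ)
dVector (p ∷ q ∷ c ∷ rs) = c ÷ p ∷ c ÷ q ∷ (p + q + hd rs) ÷ c ∷ dTail c rs

-- Coprimality of r_x and r_y captures the condition on all entries: a common divisor of the two
-- divides r₀, then r₁ by the equation at v₀, and by `tail-∣` everything after it.
IsR : ∀ {ℓ} → Vec ℕ (3 + ℓ) → Set
IsR (p ∷ q ∷ c ∷ rs) =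
  (0 < p × 0 < q × 0 < c) × (p ∣ c × q ∣ c × c ∣ p + q + hd rs) × Tail c rs × Coprime p q

pathRow : ∀ {k} → Vec ℕ k → Fin k → ℕ
pathRow rs i = Vec.sum (tabulate (λ j → bidentAdjℕ (2 + toℕ i) (2 + toℕ j) * lookup rs j))

boundary : ∀ {k} → ℕ → Fin k → ℕ
boundary a zero    = a
boundary a (suc _) = 0

-- The equations of a path whose first vertex has one further neighbour, with value `a`. Deleting
-- the first vertex makes it that further neighbour of the rest, which is what the induction along
-- the tail needs.
TailEq : ∀ {k} → ℕ → Vec ℕ k → Vec ℕ k → Set
TailEq a ds rs = ∀ i → lookup ds i * lookup rs i ≡ boundary a i + pathRow rs i

Positive : ∀ {k} → Vec ℕ k → Set
Positive v = ∀ i → 0 < lookup v i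

sum-zero : ∀ {k} (rs : Vec ℕ k) → Vec.sum (tabulate (λ j → 0 * lookup rs j)) ≡ 0
sum-zero []       = refl
sum-zero (_ ∷ rs) = sum-zero rs

row₀ : ∀ {k} (rs : Vec ℕ k) → Vec.sum (tabulate (λ j → bidentAdjℕ 2 (3 + toℕ j) * lookup rs j)) ≡ hd rs
row₀ []       = refl
row₀ (b ∷ rs) = trans (cong (1 * b +_) (sum-zero rs)) (trans (+-identityʳ (1 * b)) (*-identityˡ b))

row-suc : ∀ {k} b (rs : Vec ℕ k) i → pathRow (b ∷ rs) (suc i) ≡ boundary b i + pathRow rs i
row-suc b rs zero    = cong (_+ pathRow rs zero) (*-identityˡ b)
row-suc b rs (suc i) = refl

tail-to : ∀ {k} a (ds rs : Vec ℕ k) → Positive rs → TailEq a ds rs → Tail a rs × ds ≡ dTail a rs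
tail-to a []       []       pos eqs = [] , refl
tail-to a (d ∷ ds) (b ∷ rs) pos eqs with tail-to b ds rs (λ i → pos (suc i)) (λ i → trans (eqs (suc i)) (row-suc b rs i))
... | T , ds≡ = (pos zero , divides d (sym eq)) ∷ T , cong₂ _∷_ (÷-unique (pos zero) eq) ds≡
  where
  eq : d * b ≡ a + hd rs
  eq = trans (eqs zero) (cong (a +_) (row₀ rs))

tail-from : ∀ {k a} {rs : Vec ℕ k} → 0 < a → Tail a rs → Positive (dTail a rs) × Positive rs × TailEq a (dTail a rs) rs
tail-from 0<a [] = (λ ()) , (λ ()) , λ ()
tail-from {a = a} {rs = b ∷ rs} 0<a ((0<b , b∣) ∷ T) with tail-from 0<b T
... | posd , posr , eqs =
    (λ { zero → factor-positive (≤-trans 0<a (m≤m+n a (hd rs))) eq ; (suc i) → posd i })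
  , (λ { zero → 0<b ; (suc i) → posr i })
  , (λ { zero → trans eq (cong (a +_) (sym (row₀ rs))) ; (suc i) → trans (eqs i) (sym (row-suc b rs i)) })
  where
  eq : (a + hd rs) ÷ b * b ≡ a + hd rs
  eq = ÷-exact 0<b b∣

tail-∣ : ∀ {k g a} {rs : Vec ℕ k} → Tail a rs → g ∣ a → g ∣ hd rs → ∀ i → g ∣ lookup rs i
tail-∣ ((_ , b∣) ∷ T) g∣a g∣b zero    = g∣b
tail-∣ ((_ , b∣) ∷ T) g∣a g∣b (suc i) = tail-∣ T g∣b (∣m+n∣m⇒∣n (∣-trans g∣b b∣) g∣a) i

leaf-row : ∀ {k} c (rs : Vec ℕ k) → c + 0 + Vec.sum (tabulate (λ j → 0 * lookup rs j)) ≡ c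
leaf-row c rs = trans (cong (c + 0 +_) (sum-zero rs)) (trans (+-identityʳ (c + 0)) (+-identityʳ c))

centre-row : ∀ {k} p q (rs : Vec ℕ k) →
  1 * p + (1 * q + Vec.sum (tabulate (λ j → bidentAdjℕ 2 (3 + toℕ j) * lookup rs j))) ≡ p + q + hd rs
centre-row p q rs = trans (cong₂ (λ x y → x + (y + _)) (*-identityˡ p) (*-identityˡ q))
  (trans (sym (+-assoc p q _)) (cong (p + q +_) (row₀ rs)))

module _ {ℓ : ℕ} where

  arith⇒IsR : ∀ (d r : Vec ℕ (3 + ℓ)) → ArithBident (3 + ℓ) (d , r) → IsR r × d ≡ dVector r
  arith⇒IsR (dx ∷ dy ∷ d₀ ∷ ds) (p ∷ q ∷ c ∷ rs) (posd , posr , eqs , cop) =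
    ((0<p , 0<q , 0<c) , (p∣c , divides dy (sym eqy) , c∣) , proj₁ tail , coprime) ,
    cong₂ _∷_ (÷-unique 0<p eqx) (cong₂ _∷_ (÷-unique 0<q eqy) (cong₂ _∷_ (÷-unique 0<c eq₀) (proj₂ tail)))
    where
    0<p = posr zero
    0<q = posr (suc zero)
    0<c = posr (suc (suc zero))
    eqx : dx * p ≡ c
    eqx = trans (eqs zero) (leaf-row c rs)
    eqy : dy * q ≡ c
    eqy = trans (eqs (suc zero)) (leaf-row c rs)
    eq₀ : d₀ * c ≡ p + q + hd rs
    eq₀ = trans (eqs (suc (suc zero))) (centre-row p q rs)
    tail : Tail c rs × ds ≡ dTail c rs
    tail = tail-to c ds rs (λ i → posr (suc (suc (suc i)))) (λ i → trans (eqs (suc (suc (suc i)))) (row-suc c rs i))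
    p∣c : p ∣ c
    p∣c = divides dx (sym eqx)
    c∣ : c ∣ p + q + hd rs
    c∣ = divides d₀ (sym eq₀)
    coprime : Coprime p q
    coprime {g} (g∣p , g∣q) = cop g λ
      { zero                → g∣p
      ; (suc zero)          → g∣q
      ; (suc (suc zero))    → g∣c
      ; (suc (suc (suc i))) → tail-∣ (proj₁ tail) g∣c (∣m+n∣m⇒∣n (∣-trans g∣c c∣) (∣m∣n⇒∣m+n g∣p g∣q)) i }
      where
      g∣c : g ∣ c
      g∣c = ∣-trans g∣p p∣c

  IsR⇒arith : ∀ (r : Vec ℕ (3 + ℓ)) → IsR r → ArithBident (3 + ℓ) (dVector r , r)
  IsR⇒arith (p ∷ q ∷ c ∷ rs) ((0<p , 0<q , 0<c) , (p∣c , q∣c , c∣) , T , coprime) with tail-from 0<c T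
  ... | posd , posr , eqs =
      (λ { zero → factor-positive 0<c (÷-exact 0<p p∣c)
         ; (suc zero) → factor-positive 0<c (÷-exact 0<q q∣c)
         ; (suc (suc zero)) → factor-positive (≤-trans 0<p (≤-trans (m≤m+n p q) (m≤m+n (p + q) (hd rs)))) (÷-exact 0<c c∣)
         ; (suc (suc (suc i))) → posd i })
    , (λ { zero → 0<p ; (suc zero) → 0<q ; (suc (suc zero)) → 0<c ; (suc (suc (suc i))) → posr i })
    , (λ { zero → trans (÷-exact 0<p p∣c) (sym (leaf-row c rs))
         ; (suc zero) → trans (÷-exact 0<q q∣c) (sym (leaf-row c rs))
         ; (suc (suc zero)) → trans (÷-exact 0<c c∣) (sym (centre-row p q rs))
         ; (suc (suc (suc i))) → trans (eqs i) (sym (row-suc c rs i)) })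
    , λ g g∣ → coprime (g∣ zero , g∣ (suc zero))

-- Enumeration of the arithmetical structures

module _ {A : Set} where

  ⋃ : ℕ → (ℕ → List A) → List A
  ⋃ n f = concat (applyUpTo f n)

  length-⋃ : ∀ n f → length (⋃ n f) ≡ ∑ n (λ i → length (f i))
  length-⋃ zero    f = refl
  length-⋃ (suc n) f = trans (length-++ (f 0)) (cong (length (f 0) +_) (length-⋃ n (λ i → f (suc i))))

  ∈-⋃⁺ : ∀ {n f x} i → i < n → x ∈ f i → x ∈ ⋃ n f
  ∈-⋃⁺ {f = f} i i<n x∈ = ∈-concat⁺′ x∈ (∈-applyUpTo⁺ f i<n)

  ∈-⋃⁻ : ∀ n f {x} → x ∈ ⋃ n f → ∃ λ i → x ∈ f i
  ∈-⋃⁻ n f x∈ with ∈-concat⁻′ (applyUpTo f n) x∈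
  ... | xs , x∈xs , xs∈ with ∈-applyUpTo⁻ f xs∈
  ... | i , _ , refl = i , x∈xs

  ⋃-unique : ∀ n {f} → (∀ i → Unique (f i)) → (∀ {i j x} → x ∈ f i → x ∈ f j → i ≡ j) → Unique (⋃ n f)
  ⋃-unique n {f} uniq disj = Uniq.concat⁺ (All.applyUpTo⁺₂ f n uniq)
    (AllPairs.applyUpTo⁺₁ f n (λ i<j _ (x∈i , x∈j) → <⇒≢ i<j (disj x∈i x∈j)))

  when : ∀ {P : Set} → Dec P → List A → List A
  when (yes _) xs = xs
  when (no _)  xs = []

  when-∈⁻ : ∀ {P} (P? : Dec P) {xs x} → x ∈ when P? xs → P × x ∈ xs
  when-∈⁻ (yes p) x∈ = p , x∈

  when-yes : ∀ {P} (P? : Dec P) {xs} → P → when P? xs ≡ xs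
  when-yes (yes _) p = refl
  when-yes (no ¬p) p = ⊥-elim (¬p p)

  when-no : ∀ {P} (P? : Dec P) {xs} → ¬ P → when P? xs ≡ []
  when-no (yes p) ¬p = ⊥-elim (¬p p)
  when-no (no _)  ¬p = refl

  when-unique : ∀ {P} (P? : Dec P) {xs} → Unique xs → Unique (when P? xs)
  when-unique (yes _) u = u
  when-unique (no _)  u = []

  length-when : ∀ {P} (P? : Dec P) {xs} → length (when P? xs) ≤ length xs
  length-when (yes _) = ≤-refl
  length-when (no _)  = z≤n

-- X bounds every index u, p, δ for which there are structures.
module Enumeration (ℓ X : ℕ) (X-large : (3 + (ℓ + ℓ)) * ((3 + (ℓ + ℓ)) * suc ℓ) ≤ X) where

  R : Set
  R = Vec ℕ (3 + ℓ)

  module _ (p q c : ℕ) where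

    private
      -- The first step of the expansion is the equation at v₀; only the remaining `K` steps concern
      -- the tail. Hence the depths `suc K` in what follows.
      blockᴰ : ∀ {K} → Depth (p + q) c K → List R
      blockᴰ stop                    = []
      blockᴰ (step {K = K} b<c _ D) = map (λ rs → p ∷ q ∷ c ∷ rs) (tails (suc ℓ ∸ K) ℓ (m<n⇒0<n b<c) D)

      length-blockᴰ : ∀ {K} (D : Depth (p + q) c (suc K)) → length (blockᴰ D) ≡ ballot ℓ K
      length-blockᴰ {K} (step b<c _ D) = trans (length-map _ (tails (suc ℓ ∸ K) ℓ _ D)) eq
        where
        eq : length (tails (suc ℓ ∸ K) ℓ (m<n⇒0<n b<c) D) ≡ ballot ℓ K
        eq with ≤-total K (suc ℓ)
        ... | inj₁ K≤ = length-tails (suc ℓ ∸ K) ℓ _ D (m∸n+n≡m K≤)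
        ... | inj₂ ≤K rewrite m≤n⇒m∸n≡0 ≤K = refl

      blockᴰ-unique : ∀ {K} (D : Depth (p + q) c K) → Unique (blockᴰ D)
      blockᴰ-unique stop = []
      blockᴰ-unique (step {K = K} b<c _ D) = Uniq.map⁺ (λ { refl → refl }) (tails-unique (suc ℓ ∸ K) ℓ (m<n⇒0<n b<c) D)

      blockᴰ-sound : ∀ {K} (D : Depth (p + q) c K) {r} → r ∈ blockᴰ D →
                     ∃ λ rs → r ≡ p ∷ q ∷ c ∷ rs × 0 < c × c ∣ p + q + hd rs × Tail c rs
      blockᴰ-sound (step {b′ = b} {K = K} b<c c∣ D) r∈ with ∈-map⁻ _ r∈
      ... | rs , rs∈ , refl with tails-sound (suc ℓ ∸ K) ℓ (m<n⇒0<n b<c) D rs∈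
      ... | T , j , eq = rs , refl , m<n⇒0<n b<c ,
            subst (c ∣_) (trans (+-assoc (p + q) b (j * c)) (cong (p + q +_) (sym eq))) (∣m∣n⇒∣m+n c∣ (n∣m*n j)) , T

      blockᴰ-complete : ∀ {K} (D : Depth (p + q) c K) {rs} → 0 < c → c ∣ p + q + hd rs → Tail c rs →
                        p ∷ q ∷ c ∷ rs ∈ blockᴰ D
      blockᴰ-complete (step {K = K} b<c c∣ D) 0<c c∣′ T with residue-unique (p + q) b<c c∣ c∣′
      ... | j , eq = ∈-map⁺ _ (tails-complete (suc ℓ ∸ K) ℓ _ D
              (≤-trans (m≤n+m∸n (suc ℓ) K) (≤-reflexive (+-comm K _))) T j eq)

    block : List R
    block = blockᴰ (proj₂ (depth (p + q) c))

    length-block : ∀ {K} → Depth (p + q) c (suc K) → length block ≡ ballot ℓ K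
    length-block D with depth (p + q) c
    ... | _ , D′ with depth-unique D D′
    ... | refl = length-blockᴰ D′

    block-unique : Unique block
    block-unique = blockᴰ-unique (proj₂ (depth (p + q) c))

    block-sound : ∀ {r} → r ∈ block → ∃ λ rs → r ≡ p ∷ q ∷ c ∷ rs × 0 < c × c ∣ p + q + hd rs × Tail c rs
    block-sound = blockᴰ-sound (proj₂ (depth (p + q) c))

    block-complete : ∀ {rs} → 0 < c → c ∣ p + q + hd rs → Tail c rs → p ∷ q ∷ c ∷ rs ∈ block
    block-complete = blockᴰ-complete (proj₂ (depth (p + q) c))

    depth-≤ : ∀ {K} {rs : Vec ℕ ℓ} → Depth (p + q) c (suc K) → c ∣ p + q + hd rs → Tail c rs → K ≤ ℓ
    depth-≤ D c∣ T with D
    ... | step b<c c∣′ D′ with residue-unique (p + q) b<c c∣′ c∣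
    ... | j , eq = ≤-trans (m≤n+m _ j) (tail-length T (subst (λ z → Depth c z _) (sym eq) (shift* (m<n⇒0<n b<c) j D′)))

  abstract
    admissible? : ∀ u p δ → Dec (p ∣ u × Coprime p (p + suc δ))
    admissible? u p δ = (p ∣? u) ×-dec coprime? p (p + suc δ)

  -- r_x = p, r_y = q = p + suc δ, r₀ = u q
  cell : ℕ → ℕ → ℕ → List R
  cell u p δ = when (admissible? u p δ) (block p (p + suc δ) (u * (p + suc δ)))

  cell-sound : ∀ u p δ {r} → r ∈ cell u p δ → (p ∣ u × Coprime p (p + suc δ)) ×
    ∃ λ rs → r ≡ p ∷ (p + suc δ) ∷ (u * (p + suc δ)) ∷ rs × 0 < u * (p + suc δ) ×
      u * (p + suc δ) ∣ p + (p + suc δ) + hd rs × Tail (u * (p + suc δ)) rs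
  cell-sound u p δ r∈ with when-∈⁻ (admissible? u p δ) r∈
  ... | adm , r∈′ = adm , block-sound _ _ _ r∈′

  -- A bound for u. If r_x < r_y, then `bound w 0` at most ℓ forces u ≤ 2ℓ + 1; for r_x = r_y = 1
  -- the descent by 2 allows r₀ up to 2ℓ + 3.
  T : ℕ
  T = 3 + (ℓ + ℓ)

  T≤X : T ≤ X
  T≤X = ≤-trans (≤-trans (m≤m*n T (suc ℓ)) (m≤n*m (T * suc ℓ) T)) X-large

  ℓ<X : ℓ < X
  ℓ<X = ≤-trans (s≤s (≤-trans (m≤m+n ℓ ℓ) (m≤n+m (ℓ + ℓ) 2))) T≤X

  cellsᵖ : ℕ → ℕ → List R
  cellsᵖ u′ p′ = ⋃ X (cell (suc u′) (suc p′))

  cellsᵘ : ℕ → List R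
  cellsᵘ u′ = ⋃ (suc u′) (cellsᵖ u′)

  increasing : List R
  increasing = ⋃ X cellsᵘ

  diagonal : List R
  diagonal = ⋃ X (λ u′ → block 1 1 (suc u′))

  swap : R → R
  swap (p ∷ q ∷ v) = q ∷ p ∷ v

  swap-injective : ∀ {r r′} → swap r ≡ swap r′ → r ≡ r′
  swap-injective {_ ∷ _ ∷ _} {_ ∷ _ ∷ _} refl = refl

  vectors : List R
  vectors = increasing ++ map swap increasing ++ diagonal

  rx ry r₀ : R → ℕ
  rx = Vec.head
  ry = Vec.head ∘ Vec.tail
  r₀ = Vec.head ∘ Vec.tail ∘ Vec.tail

  cell-entries : ∀ u p δ {r} → r ∈ cell u p δ → rx r ≡ p × ry r ≡ p + suc δ × r₀ r ≡ u * (p + suc δ)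
  cell-entries u p δ r∈ with cell-sound u p δ r∈
  ... | _ , _ , eq , _ = cong rx eq , cong ry eq , cong r₀ eq

  cellsᵖ-unique : ∀ u′ p′ → Unique (cellsᵖ u′ p′)
  cellsᵖ-unique u′ p′ = ⋃-unique X (λ δ → when-unique (admissible? (suc u′) (suc p′) δ) (block-unique _ _ _)) disjoint
    where
    disjoint : ∀ {δ δ′ r} → r ∈ cell (suc u′) (suc p′) δ → r ∈ cell (suc u′) (suc p′) δ′ → δ ≡ δ′
    disjoint {δ} {δ′} r∈ r∈′ =
      let _ , y≡  , _ = cell-entries (suc u′) (suc p′) δ r∈
          _ , y≡′ , _ = cell-entries (suc u′) (suc p′) δ′ r∈′
      in suc-injective (+-cancelˡ-≡ (suc p′) _ _ (trans (sym y≡) y≡′))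

  ∈-cellsᵘ⁻ : ∀ u′ {r} → r ∈ cellsᵘ u′ → ∃ λ p′ → ∃ λ δ → r ∈ cell (suc u′) (suc p′) δ
  ∈-cellsᵘ⁻ u′ r∈ =
    let p′ , r∈′ = ∈-⋃⁻ (suc u′) (cellsᵖ u′) r∈
    in p′ , ∈-⋃⁻ X (cell (suc u′) (suc p′)) r∈′

  cellsᵘ-unique : ∀ u′ → Unique (cellsᵘ u′)
  cellsᵘ-unique u′ = ⋃-unique (suc u′) (cellsᵖ-unique u′) disjoint
    where
    disjoint : ∀ {i j r} → r ∈ cellsᵖ u′ i → r ∈ cellsᵖ u′ j → i ≡ j
    disjoint {i} {j} r∈ r∈′ =
      let δ  , ∈₁ = ∈-⋃⁻ X (cell (suc u′) (suc i)) r∈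
          δ′ , ∈₂ = ∈-⋃⁻ X (cell (suc u′) (suc j)) r∈′
          x≡  , _ = cell-entries (suc u′) (suc i) δ ∈₁
          x≡′ , _ = cell-entries (suc u′) (suc j) δ′ ∈₂
      in suc-injective (trans (sym x≡) x≡′)

  increasing-unique : Unique increasing
  increasing-unique = ⋃-unique X cellsᵘ-unique disjoint
    where
    disjoint : ∀ {i j r} → r ∈ cellsᵘ i → r ∈ cellsᵘ j → i ≡ j
    disjoint {i} {j} r∈ r∈′ =
      let p  , δ  , ∈₁ = ∈-cellsᵘ⁻ i r∈
          p′ , δ′ , ∈₂ = ∈-cellsᵘ⁻ j r∈′
          _ , y≡  , c≡  = cell-entries (suc i) (suc p) δ ∈₁
          _ , y≡′ , c≡′ = cell-entries (suc j) (suc p′) δ′ ∈₂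
      in suc-injective (*-cancelʳ-≡ (suc i) (suc j) (suc p + suc δ)
           (trans (sym c≡) (trans c≡′ (cong (suc j *_) (trans (sym y≡′) y≡)))))

  Ordered : R → Set
  Ordered (p ∷ q ∷ _) = p < q

  cell-valid : ∀ u p δ {r} → 0 < p → r ∈ cell u p δ → IsR r × Ordered r
  cell-valid u p δ 0<p r∈ with cell-sound u p δ r∈
  ... | (p∣u , cop) , rs , refl , 0<c , c∣ , T =
    ((0<p , ≤-trans 0<p (m≤m+n p (suc δ)) , 0<c) , (∣-trans p∣u (m∣m*n (p + suc δ)) , n∣m*n u , c∣) , T , cop) ,
    m<m+n p (s≤s z≤n)

  increasing-sound : ∀ {r} → r ∈ increasing → IsR r × Ordered r
  increasing-sound {r} r∈ =
    let u′ , ∈₁ = ∈-⋃⁻ X cellsᵘ r∈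
        p′ , δ , ∈₂ = ∈-cellsᵘ⁻ u′ ∈₁
    in cell-valid (suc u′) (suc p′) δ (s≤s z≤n) ∈₂

  diagonal-sound : ∀ {r} → r ∈ diagonal → IsR r × ∃ λ v → r ≡ 1 ∷ 1 ∷ v
  diagonal-sound r∈ with ∈-⋃⁻ X (λ u′ → block 1 1 (suc u′)) r∈
  ... | u′ , r∈ with block-sound 1 1 (suc u′) r∈
  ... | rs , refl , 0<c , c∣ , T = ((s≤s z≤n , s≤s z≤n , 0<c) , (1∣ _ , 1∣ _ , c∣) , T , Coprimality.1-coprimeTo 1) , _ , refl

  swap-IsR : ∀ {r} → IsR r → IsR (swap r)
  swap-IsR {p ∷ q ∷ c ∷ rs} ((0<p , 0<q , 0<c) , (p∣c , q∣c , c∣) , T , cop) =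
    (0<q , 0<p , 0<c) , (q∣c , p∣c , subst (λ z → c ∣ z + hd rs) (+-comm p q) c∣) , T , Coprimality.sym cop

  vectors-sound : ∀ {r} → r ∈ vectors → IsR r
  vectors-sound r∈ with ∈-++⁻ increasing r∈
  ... | inj₁ r∈₁ = proj₁ (increasing-sound r∈₁)
  ... | inj₂ r∈′ with ∈-++⁻ (map swap increasing) r∈′
  ...   | inj₂ r∈₃ = proj₁ (diagonal-sound r∈₃)
  ...   | inj₁ r∈₂ with ∈-map⁻ swap r∈₂
  ...     | r , r∈″ , refl = swap-IsR (proj₁ (increasing-sound r∈″))

  vectors-unique : Unique vectors
  vectors-unique = Uniq.++⁺ increasing-unique
    (Uniq.++⁺ (Uniq.map⁺ swap-injective increasing-unique)
      (⋃-unique X (λ u′ → block-unique 1 1 (suc u′)) disjoint₁) disjoint₂) disjoint₃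
    where
    disjoint₁ : ∀ {i j r} → r ∈ block 1 1 (suc i) → r ∈ block 1 1 (suc j) → i ≡ j
    disjoint₁ {i} {j} r∈ r∈′ with block-sound 1 1 (suc i) r∈ | block-sound 1 1 (suc j) r∈′
    ... | _ , refl , _ | _ , eq , _ = suc-injective (cong (Vec.head ∘ Vec.tail ∘ Vec.tail) eq)
    disjoint₂ : ∀ {r} → r ∈ map swap increasing × r ∈ diagonal → ⊥
    disjoint₂ (r∈ , r∈′) with ∈-map⁻ swap r∈ | diagonal-sound r∈′
    ... | (_ ∷ _ ∷ _) , r∈″ , refl | _ , _ , refl = <-irrefl refl (proj₂ (increasing-sound r∈″))
    disjoint₃ : ∀ {r} → r ∈ increasing × r ∈ map swap increasing ++ diagonal → ⊥
    disjoint₃ (r∈ , r∈′) with ∈-++⁻ (map swap increasing) r∈′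
    ... | inj₁ r∈″ with ∈-map⁻ swap r∈″
    ...   | (_ ∷ _ ∷ _) , r∈₁ , refl = <-asym (proj₂ (increasing-sound r∈)) (proj₂ (increasing-sound r∈₁))
    disjoint₃ (r∈ , r∈′) | inj₂ r∈₂ with diagonal-sound r∈₂
    ...   | _ , _ , refl = <-irrefl refl (proj₂ (increasing-sound r∈))

  ∸half-≤ : ∀ x → x ∸ x / 2 ≤ ℓ → x ≤ ℓ + ℓ
  ∸half-≤ x x∸h≤ℓ = ≤-trans x≤ℓ+h (+-monoʳ-≤ ℓ (+-cancelʳ-≤ h h ℓ (≤-trans h+h≤x x≤ℓ+h)))
    where
    h : ℕ
    h = x / 2
    x≤ℓ+h : x ≤ ℓ + h
    x≤ℓ+h = ≤-trans (m≤n+m∸n x h) (≤-trans (≤-reflexive (+-comm h (x ∸ h))) (+-monoˡ-≤ h x∸h≤ℓ))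
    h+h≤x : h + h ≤ x
    h+h≤x = ≤-trans (≤-reflexive (lem h)) (m/n*n≤m x 2)
      where
      lem : ∀ h → h + h ≡ h * 2
      lem = solve-∀

  index-bounds : ∀ u′ p′ δ {K} → suc p′ ∣ suc u′ →
                 Depth (suc p′ + (suc p′ + suc δ)) (suc u′ * (suc p′ + suc δ)) (suc K) → K ≤ ℓ → u′ < X × δ < X
  index-bounds zero p′ δ p∣1 D K≤ℓ with ∣1⇒≡1 p∣1
  ... | refl = m<n⇒0<n ℓ<X , ≤-trans (≤-reflexive (suc-injective (depth-unique (depth-q-1 (suc δ)) D))) (≤-trans K≤ℓ (<⇒≤ ℓ<X))
  index-bounds (suc w) p′ δ {K} p∣u D K≤ℓ = ≤-trans u≤T T≤X , ≰⇒> ¬X≤δ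
    where
    open ≤-Reasoning
    p u : ℕ
    p = suc p′
    u = suc (suc w)
    s≡ : p + (p + suc δ) ≡ suc (p * 2 + δ)
    s≡ = lem p δ
      where
      lem : ∀ p δ → p + (p + suc δ) ≡ suc (p * 2 + δ)
      lem = solve-∀
    u≤T : u ≤ T
    u≤T = s≤s (≤-trans (∸half-≤ (suc w) (≤-trans
             (depth-bound p δ w (s≤s z≤n) D 0 (≤-trans (s≤s (m≤m+n (p * 2) δ)) (≤-reflexive (sym s≡)))) K≤ℓ))
            (m≤n+m _ 2))
    ¬X≤δ : ¬ X ≤ δ
    -- The index i = u (ℓ + 1) makes `bound′ w i` equal to w + ℓ + 1, too large for a tail of length
    -- ℓ. Since p ≤ u ≤ T, the size of X ensures p i < p + q.
    ¬X≤δ X≤δ = <⇒≱ (s≤s (≤-refl {ℓ})) (begin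
      suc ℓ                          ≤⟨ m≤n+m (suc ℓ) w ⟩
      w + suc ℓ                      ≡⟨ cong (w +_) (sym (trans (cong (_/ u) (*-comm u (suc ℓ))) (m*n/n≡m (suc ℓ) u))) ⟩
      w + (u * suc ℓ) / u            ≤⟨ depth-bound′ p δ w (s≤s z≤n) D (u * suc ℓ) (m≤m*n u (suc ℓ)) p*i<s ⟩
      K                              ≤⟨ K≤ℓ ⟩
      ℓ                              ∎)
      where
      p*i<s : p * (u * suc ℓ) < p + (p + suc δ)
      p*i<s = begin-strict
        p * (u * suc ℓ)              ≤⟨ *-mono-≤ (≤-trans (∣⇒≤ p∣u) u≤T) (*-monoˡ-≤ (suc ℓ) u≤T) ⟩
        T * (T * suc ℓ)              ≤⟨ ≤-trans X-large X≤δ ⟩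
        δ                            <⟨ s≤s (m≤n+m δ (p * 2)) ⟩
        suc (p * 2 + δ)              ≡⟨ sym s≡ ⟩
        p + (p + suc δ)              ∎

  depth-suc : ∀ a {b} → 0 < b → ∃ λ K → Depth a b (suc K)
  depth-suc a {suc b} 0<b with depth a (suc b)
  ... | suc K , D = K , D

  increasing-complete : ∀ {r} → IsR r → Ordered r → r ∈ increasing
  increasing-complete {p ∷ q ∷ c ∷ rs} ((0<p , 0<q , 0<c) , (p∣c , divides u refl , c∣) , T , cop) p<q
    with m≤n⇒∃[o]m+o≡n p<q
  ... | δ , eq with trans (+-suc p δ) eq
  ... | refl = go p u 0<p 0<c p∣c c∣ T cop
    where
    go : ∀ p u → 0 < p → 0 < u * (p + suc δ) → p ∣ u * (p + suc δ) → u * (p + suc δ) ∣ p + (p + suc δ) + hd rs →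
         Tail (u * (p + suc δ)) rs → Coprime p (p + suc δ) → p ∷ (p + suc δ) ∷ (u * (p + suc δ)) ∷ rs ∈ increasing
    go (suc p′) (suc u′) 0<p 0<c p∣c c∣ T cop =
      ∈-⋃⁺ {f = cellsᵘ} u′ (proj₁ bounds) (∈-⋃⁺ {f = cellsᵖ u′} p′ (∣⇒≤ p∣u) (∈-⋃⁺ {f = cell (suc u′) (suc p′)} δ (proj₂ bounds)
        (subst (_ ∈_) (sym (when-yes (admissible? (suc u′) (suc p′) δ) (p∣u , cop))) (block-complete _ _ _ 0<c c∣ T))))
      where
      p∣u : suc p′ ∣ suc u′
      p∣u = coprime-divisor cop (subst (suc p′ ∣_) (*-comm (suc u′) _) p∣c)
      bounds : u′ < X × δ < X
      bounds with depth-suc (suc p′ + (suc p′ + suc δ)) 0<c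
      ... | K , D = index-bounds u′ p′ δ p∣u D (depth-≤ (suc p′) (suc p′ + suc δ) _ D c∣ T)

  diagonal-complete : ∀ {c rs} → IsR (1 ∷ 1 ∷ c ∷ rs) → 1 ∷ 1 ∷ c ∷ rs ∈ diagonal
  diagonal-complete {suc c} {rs} ((_ , _ , 0<c) , (_ , _ , c∣) , T′ , _) = ∈-⋃⁺ c (≤-trans (c≤T c c∣ T′) T≤X) (block-complete 1 1 (suc c) 0<c c∣ T′)
    where
    c≤T : ∀ c → suc c ∣ 2 + hd rs → Tail (suc c) rs → suc c ≤ T
    c≤T zero          _  _  = s≤s z≤n
    c≤T (suc zero)    _  _  = s≤s (s≤s z≤n)
    c≤T (suc (suc k)) c∣ T′ with depth-suc 2 {3 + k} (s≤s z≤n)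
    ... | K , D = +-monoʳ-≤ 3 (≤-trans (≤-reflexive (m≡m%n+[m/n]*n k 2))
      (≤-trans (+-monoˡ-≤ (k / 2 * 2) (s≤s⁻¹ (m%n<n k 2)))
        (lem (k / 2) (≤-trans (depth-1-1-≥ k D) (depth-≤ 1 1 (3 + k) D c∣ T′)))))
      where
      lem : ∀ h → suc h ≤ ℓ → 1 + h * 2 ≤ ℓ + ℓ
      lem h h<ℓ = ≤-trans (≤-trans (n≤1+n _) (≤-reflexive (lem′ h))) (+-mono-≤ h<ℓ h<ℓ)
        where
        lem′ : ∀ h → 2 + h * 2 ≡ suc h + suc h
        lem′ = solve-∀

  vectors-complete : ∀ {r} → IsR r → r ∈ vectors
  vectors-complete {p ∷ q ∷ c ∷ rs} isR with <-cmp p q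
  ... | tri< p<q _ _ = ∈-++⁺ˡ (increasing-complete isR p<q)
  ... | tri> _ _ q<p = ∈-++⁺ʳ increasing (∈-++⁺ˡ (∈-map⁺ swap (increasing-complete (swap-IsR {p ∷ q ∷ c ∷ rs} isR) q<p)))
  ... | tri≈ _ refl _ with proj₂ (proj₂ (proj₂ isR)) {p} (∣-refl , ∣-refl)
  ...   | refl = ∈-++⁺ʳ increasing (∈-++⁺ʳ (map swap increasing) (diagonal-complete isR))

  structures : List (R × R)
  structures = map (λ r → dVector r , r) vectors

  structures-unique : Unique structures
  structures-unique = Uniq.map⁺ (λ eq → cong proj₂ eq) vectors-unique

  ∈-structures : ∀ x → (x ∈ structures) ⇔ ArithBident (3 + ℓ) x
  ∈-structures (d , r) = mk⇔ to from
    where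
    to : (d , r) ∈ structures → ArithBident (3 + ℓ) (d , r)
    to x∈ with ∈-map⁻ _ x∈
    ... | r , r∈ , refl = IsR⇒arith r (vectors-sound r∈)
    from : ArithBident (3 + ℓ) (d , r) → (d , r) ∈ structures
    from arith with arith⇒IsR d r arith
    ... | isR , refl = ∈-map⁺ _ (vectors-complete isR)

  length-structures : length structures ≡ 2 * length increasing + length diagonal
  length-structures = begin
    length structures                                                          ≡⟨ length-map _ vectors ⟩
    length vectors                                                             ≡⟨ length-++ increasing ⟩
    length increasing + length (map swap increasing ++ diagonal)                  ≡⟨ cong (length increasing +_) (length-++ (map swap increasing)) ⟩
    length increasing + (length (map swap increasing) + length diagonal)          ≡⟨ cong (λ z → length increasing + (z + length diagonal)) (length-map swap increasing) ⟩
    length increasing + (length increasing + length diagonal)                     ≡⟨ lem (length increasing) (length diagonal) ⟩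
    2 * length increasing + length diagonal                                       ∎
    where
    open ≡-Reasoning
    lem : ∀ a b → a + (a + b) ≡ 2 * a + b
    lem = solve-∀

-- Numerical estimates

catalan-positive : ∀ ℓ → 0 < catalan ℓ
catalan-positive ℓ = subst (0 <_) (sym (catalan≡G ℓ)) (go ℓ 0)
  where
  go : ∀ m K → 0 < G (suc m) K
  go m       (suc K) = ≤-trans (go m K) (m≤m+n _ _)
  go zero    zero    = s≤s z≤n
  go (suc m) zero    = go m 1

-- The function `g` is a certificate: g i dominates the sum of b (i + j) / 2^j over j, because b i ≤
-- g i - g (suc i) / 2. Thus a series is bounded by checking one inequality per index.
geometric-tail : ∀ n (a b g : ℕ → ℕ) κ → (∀ i → 2 ^ i * a i ≤ b i * κ) →
                 (∀ i → 2 * b i + g (suc i) ≤ 2 * g i) → ∑ n a ≤ g 0 * κ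
geometric-tail zero    a b g κ a≤ b≤ = z≤n
geometric-tail (suc n) a b g κ a≤ b≤ = *-cancelˡ-≤ 2 (begin
  2 * (a 0 + S)                      ≡⟨ *-distribˡ-+ 2 (a 0) S ⟩
  2 * a 0 + 2 * S                    ≡⟨ cong₂ (λ x y → 2 * x + y) (sym (*-identityˡ (a 0))) (sym (∑-*ˡ n 2 (λ i → a (suc i)))) ⟩
  2 * (1 * a 0) + ∑ n (λ i → 2 * a (suc i)) ≤⟨ +-mono-≤ (*-monoʳ-≤ 2 (a≤ 0)) rec ⟩
  2 * (b 0 * κ) + g 1 * κ            ≡⟨ lem (b 0) (g 1) κ ⟩
  (2 * b 0 + g 1) * κ                ≤⟨ *-monoˡ-≤ κ (b≤ 0) ⟩
  2 * g 0 * κ                        ≡⟨ *-assoc 2 (g 0) κ ⟩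
  2 * (g 0 * κ)                      ∎)
  where
  open ≤-Reasoning
  S : ℕ
  S = ∑ n (λ i → a (suc i))
  rec : ∑ n (λ i → 2 * a (suc i)) ≤ g 1 * κ
  rec = geometric-tail n (λ i → 2 * a (suc i)) (λ i → b (suc i)) (λ i → g (suc i)) κ
          (λ i → ≤-trans (≤-reflexive (lem′ (2 ^ i) (a (suc i)))) (a≤ (suc i))) (λ i → b≤ (suc i))
    where
    lem′ : ∀ x y → x * (2 * y) ≡ 2 * x * y
    lem′ = solve-∀
  lem : ∀ b g κ → 2 * (b * κ) + g * κ ≡ (2 * b + g) * κ
  lem = solve-∀

weight : ∀ {P : Set} → Dec P → ℕ → ℕ
weight (yes _) p = p
weight (no _)  p = 0

-- The divisor sum of w + 2.
σ : ℕ → ℕ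
σ w = ∑ (2 + w) (λ p → weight (suc p ∣? 2 + w) (suc p))

σ-≤ : ∀ w → σ w ≤ (2 + w) * (2 + w)
σ-≤ w = ≤-trans (∑-mono (2 + w) (λ p → go p (suc p ∣? 2 + w))) (≤-reflexive (∑-const (2 + w) (2 + w)))
  where
  go : ∀ p (d : Dec (suc p ∣ 2 + w)) → weight d (suc p) ≤ 2 + w
  go p (yes d) = ∣⇒≤ d
  go p (no _)  = z≤n

-- 2^64 (K + 1) / 2^K, rounded up to K + 1 for K > 64.
W : ℕ → ℕ
W K = 2 ^ (64 ∸ K) * suc K

ballot-≤-W : ∀ ℓ K → 2 ^ 64 * ballot ℓ K ≤ W K * catalan ℓ
ballot-≤-W ℓ K = begin
  2 ^ 64 * ballot ℓ K                      ≤⟨ *-monoˡ-≤ (ballot ℓ K) (^-monoʳ-≤ 2 (m≤n+m∸n 64 K)) ⟩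
  2 ^ (K + (64 ∸ K)) * ballot ℓ K          ≡⟨ cong (_* ballot ℓ K) (^-distribˡ-+-* 2 K (64 ∸ K)) ⟩
  2 ^ K * 2 ^ (64 ∸ K) * ballot ℓ K        ≡⟨ lem (2 ^ K) (2 ^ (64 ∸ K)) (ballot ℓ K) ⟩
  2 ^ (64 ∸ K) * (2 ^ K * ballot ℓ K)      ≤⟨ *-monoʳ-≤ (2 ^ (64 ∸ K)) (ballot-decay ℓ K) ⟩
  2 ^ (64 ∸ K) * (suc K * catalan ℓ)       ≡⟨ sym (*-assoc (2 ^ (64 ∸ K)) (suc K) (catalan ℓ)) ⟩
  W K * catalan ℓ                          ∎
  where
  open ≤-Reasoning
  lem : ∀ a b c → a * b * c ≡ b * (a * c)
  lem = solve-∀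

-- A numerical majorant, free of ℓ, for 2^64 times `Y` divided by C(ℓ). The factor 4 comes from C(ℓ
-- + 1) ≤ 4 C(ℓ).
Yᴺ : ℕ → ℕ
Yᴺ w = (2 + w) * (W (2 + w) * 4) + ∑ w (λ i → W (bound w i))

-- Verified by evaluation. The 38 terms are u = 2, ..., 39; the analytic tail estimate takes over at
-- u = 40. The factor 2 accounts for mirror images.
numeric : 2 * ∑ 38 (λ w → σ w * Yᴺ w) ≤ 610 * 2 ^ 64
numeric = ≤ᵇ⇒≤ _ _ tt

module _ (ℓ : ℕ) where

  -- The number of r-vectors with r_x < r_y and r₀ = u r_y, where u = w + 2, is
  -- at most σ w * Y w.
  Y : ℕ → ℕ
  Y w = (2 + w) * ballot (suc ℓ) (2 + w) + ∑ w (λ i → ballot ℓ (bound w i))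

  private
    κ : ℕ
    κ = catalan ℓ

  ballot-suc-≤ : ∀ K → 2 ^ K * ballot (suc ℓ) K ≤ 4 * suc K * κ
  ballot-suc-≤ K = ≤-trans (ballot-decay (suc ℓ) K) (≤-trans (*-monoʳ-≤ (suc K) (catalan-suc-≤ ℓ)) (≤-reflexive (lem (suc K) κ)))
    where
    lem : ∀ a b → a * (4 * b) ≡ 4 * a * b
    lem = solve-∀

  Y-≤-Yᴺ : ∀ w → 2 ^ 64 * Y w ≤ Yᴺ w * κ
  Y-≤-Yᴺ w = go (2 ^ 64) refl
    where
    open ≤-Reasoning
    lem₁ : ∀ q u b S → q * (u * b + S) ≡ u * (q * b) + q * S
    lem₁ = solve-∀
    lem₂ : ∀ u x κ S → u * (x * (4 * κ)) + S * κ ≡ (u * (x * 4) + S) * κ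
    lem₂ = solve-∀
    go : ∀ Q → Q ≡ 2 ^ 64 → Q * Y w ≤ Yᴺ w * κ
    go Q refl = begin
      Q * Y w
        ≡⟨ lem₁ Q (2 + w) (ballot (suc ℓ) (2 + w)) _ ⟩
      (2 + w) * (Q * ballot (suc ℓ) (2 + w)) + Q * ∑ w (λ i → ballot ℓ (bound w i))
        ≡⟨ cong ((2 + w) * (Q * ballot (suc ℓ) (2 + w)) +_) (sym (∑-*ˡ w Q _)) ⟩
      (2 + w) * (Q * ballot (suc ℓ) (2 + w)) + ∑ w (λ i → Q * ballot ℓ (bound w i))
        ≤⟨ +-mono-≤ (*-monoʳ-≤ (2 + w) (≤-trans (ballot-≤-W (suc ℓ) (2 + w)) (*-monoʳ-≤ (W (2 + w)) (catalan-suc-≤ ℓ))))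
                    (∑-mono w (λ i → ballot-≤-W ℓ (bound w i))) ⟩
      (2 + w) * (W (2 + w) * (4 * κ)) + ∑ w (λ i → W (bound w i) * κ)
        ≡⟨ cong ((2 + w) * (W (2 + w) * (4 * κ)) +_) (∑-*ʳ w κ _) ⟩
      (2 + w) * (W (2 + w) * (4 * κ)) + ∑ w (λ i → W (bound w i)) * κ
        ≡⟨ lem₂ (2 + w) (W (2 + w)) κ _ ⟩
      Yᴺ w * κ ∎

  scaled : ∀ N M → 2 * ∑ N (λ w → σ w * Yᴺ w) ≤ M * 2 ^ 64 → 2 * ∑ N (λ w → σ w * Y w) ≤ M * κ
  scaled N M h = go (2 ^ 64) refl ⦃ m^n≢0 2 64 ⦄
    where
    open ≤-Reasoning
    S : ℕ
    S = ∑ N (λ w → σ w * Yᴺ w)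
    lem : ∀ q s → q * (2 * s) ≡ 2 * (q * s)
    lem = solve-∀
    lem′ : ∀ q s y → q * (s * y) ≡ s * (q * y)
    lem′ = solve-∀
    lem″ : ∀ x q c → x * q * c ≡ q * (x * c)
    lem″ = solve-∀
    -- The power of two is kept as a variable, so that the algebra below never meets the numeral.
    go : ∀ Q → Q ≡ 2 ^ 64 → .⦃ _ : NonZero Q ⦄ → 2 * ∑ N (λ w → σ w * Y w) ≤ M * κ
    go Q Q≡ = *-cancelˡ-≤ Q (begin
      Q * (2 * ∑ N (λ w → σ w * Y w))        ≡⟨ lem Q _ ⟩
      2 * (Q * ∑ N (λ w → σ w * Y w))        ≡⟨ cong (2 *_) (sym (∑-*ˡ N Q _)) ⟩
      2 * ∑ N (λ w → Q * (σ w * Y w))        ≤⟨ *-monoʳ-≤ 2 (∑-mono N term) ⟩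
      2 * ∑ N (λ w → σ w * Yᴺ w * κ)         ≡⟨ cong (2 *_) (∑-*ʳ N κ (λ w → σ w * Yᴺ w)) ⟩
      2 * (S * κ)                            ≡⟨ sym (*-assoc 2 S κ) ⟩
      2 * S * κ                              ≤⟨ *-monoˡ-≤ κ (subst (λ q → 2 * S ≤ M * q) (sym Q≡) h) ⟩
      M * Q * κ                              ≡⟨ lem″ M Q κ ⟩
      Q * (M * κ)                            ∎)
      where
      term : ∀ w → Q * (σ w * Y w) ≤ σ w * Yᴺ w * κ
      term w = begin
        Q * (σ w * Y w)          ≡⟨ lem′ Q (σ w) (Y w) ⟩
        σ w * (Q * Y w)          ≤⟨ *-monoʳ-≤ (σ w) (subst (λ q → q * Y w ≤ Yᴺ w * κ) (sym Q≡) (Y-≤-Yᴺ w)) ⟩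
        σ w * (Yᴺ w * κ)         ≡⟨ sym (*-assoc (σ w) (Yᴺ w) κ) ⟩
        σ w * Yᴺ w * κ           ∎

  head-≤ : 2 * ∑ 38 (λ w → σ w * Y w) ≤ 610 * κ
  head-≤ = scaled 38 610 numeric

  -- The least value of `bound w i` is at i = 0, where it is u / 2 rounded down.
  half-≤-bound : ∀ v w i → v + v ≤ 2 + w → v ≤ bound w i
  half-≤-bound v w i 2v≤ = ≤-trans (m+n≤o⇒m≤o∸n v v+h≤) (∸-monoʳ-≤ (suc w) (/-monoʳ-≤ (suc w) (s≤s (s≤s z≤n))))
    where
    h : ℕ
    h = suc w / 2
    2h≤ : h + h ≤ suc w
    2h≤ = ≤-trans (≤-reflexive (lem h)) (m/n*n≤m (suc w) 2)
      where
      lem : ∀ h → h + h ≡ h * 2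
      lem = solve-∀
    v+h≤ : v + h ≤ suc w
    v+h≤ = ≮⇒≥ λ w<v+h → <⇒≱ (s≤s (≤-refl {3 + w + w})) (≤-trans
      (≤-trans (≤-reflexive (lem₁ w)) (≤-trans (+-mono-≤ w<v+h w<v+h) (≤-reflexive (lem₂ v h)))) (≤-trans (+-mono-≤ 2v≤ 2h≤) (≤-reflexive (lem₃ w))))
      where
      lem₁ : ∀ w → 4 + w + w ≡ 2 + w + (2 + w)
      lem₁ = solve-∀
      lem₂ : ∀ v h → v + h + (v + h) ≡ v + v + (h + h)
      lem₂ = solve-∀
      lem₃ : ∀ w → 2 + w + (1 + w) ≡ 3 + w + w
      lem₃ = solve-∀

  linear-≤-power : ∀ {v} → 20 ≤′ v → 4 * (1 + 2 * v) ≤ 2 ^ v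
  linear-≤-power ≤′-refl = ≤ᵇ⇒≤ _ _ tt
  linear-≤-power {suc v} (≤′-step 20≤v) = begin
    4 * (1 + 2 * suc v)                 ≡⟨ lem v ⟩
    8 + 4 * (1 + 2 * v)                 ≤⟨ +-monoˡ-≤ _ (*-monoʳ-≤ 4 (s≤s (≤-trans (≤-trans (s≤s z≤n) (≤′⇒≤ 20≤v)) (m≤m+n v _)))) ⟩
    4 * (1 + 2 * v) + 4 * (1 + 2 * v)   ≤⟨ +-mono-≤ (linear-≤-power 20≤v) (linear-≤-power 20≤v) ⟩
    2 ^ v + 2 ^ v                       ≡⟨ cong (2 ^ v +_) (sym (+-identityʳ _)) ⟩
    2 ^ suc v                           ∎
    where
    open ≤-Reasoning
    lem : ∀ v → 4 * (1 + 2 * suc v) ≡ 8 + 4 * (1 + 2 * v)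
    lem = solve-∀

  -- Here v is u / 2 rounded down, and crude bounds suffice: σ w ≤ u², each `bound w i` is at least
  -- v, and the ballot number in row `suc ℓ` decays like 4^(-v), of which one factor 2^(-v) absorbs
  -- its linear coefficient.
  tail-term : ∀ v w → 20 ≤ v → v + v ≤ 2 + w → 2 + w ≤ 1 + 2 * v →
              2 ^ v * (σ w * Y w) ≤ (1 + 2 * v) * ((1 + 2 * v) * ((1 + 2 * v) * (2 + v))) * κ
  tail-term v w 20≤v 2v≤u u≤ = begin
      2 ^ v * (σ w * Y w)          ≡⟨ lem₁ (2 ^ v) (σ w) (Y w) ⟩
      σ w * (2 ^ v * Y w)          ≤⟨ *-mono-≤ (σ-≤ w) Y≤ ⟩
      u * u * (u * (2 + v) * κ)    ≡⟨ lem₂ u (2 + v) κ ⟩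
      u * (u * (u * (2 + v))) * κ  ≤⟨ *-monoˡ-≤ κ (*-mono-≤ u≤ (*-mono-≤ u≤ (*-monoˡ-≤ (2 + v) u≤))) ⟩
      (1 + 2 * v) * ((1 + 2 * v) * ((1 + 2 * v) * (2 + v))) * κ ∎
      where
      open ≤-Reasoning
      u : ℕ
      u = 2 + w
      lem₁ : ∀ a b c → a * (b * c) ≡ b * (a * c)
      lem₁ = solve-∀
      lem₂ : ∀ u v c → u * u * (u * v * c) ≡ u * (u * (u * v)) * c
      lem₂ = solve-∀
      A≤ : 2 ^ v * ballot (suc ℓ) u ≤ κ
      A≤ = *-cancelˡ-≤ (2 ^ v) ⦃ m^n≢0 2 v ⦄ (begin
        2 ^ v * (2 ^ v * ballot (suc ℓ) u)        ≡⟨ sym (*-assoc (2 ^ v) (2 ^ v) _) ⟩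
        2 ^ v * 2 ^ v * ballot (suc ℓ) u          ≡⟨ cong (_* ballot (suc ℓ) u) (sym (^-distribˡ-+-* 2 v v)) ⟩
        2 ^ (v + v) * ballot (suc ℓ) u            ≤⟨ *-monoʳ-≤ (2 ^ (v + v)) (ballot-decreasing (suc ℓ) 2v≤u) ⟩
        2 ^ (v + v) * ballot (suc ℓ) (v + v)      ≤⟨ ballot-suc-≤ (v + v) ⟩
        4 * suc (v + v) * κ                       ≡⟨ cong (λ z → 4 * suc (v + z) * κ) (sym (+-identityʳ v)) ⟩
        4 * (1 + 2 * v) * κ                       ≤⟨ *-monoˡ-≤ κ (linear-≤-power (≤⇒≤′ 20≤v)) ⟩
        2 ^ v * κ                                 ∎)
      B≤ : 2 ^ v * ∑ w (λ i → ballot ℓ (bound w i)) ≤ w * (suc v * κ)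
      B≤ = begin
        2 ^ v * ∑ w (λ i → ballot ℓ (bound w i))   ≤⟨ *-monoʳ-≤ (2 ^ v) (∑-mono w (λ i → ballot-decreasing ℓ (half-≤-bound v w i 2v≤u))) ⟩
        2 ^ v * ∑ w (λ i → ballot ℓ v)             ≡⟨ cong (2 ^ v *_) (∑-const w (ballot ℓ v)) ⟩
        2 ^ v * (w * ballot ℓ v)                   ≡⟨ lem₁ (2 ^ v) w (ballot ℓ v) ⟩
        w * (2 ^ v * ballot ℓ v)                   ≤⟨ *-monoʳ-≤ w (ballot-decay ℓ v) ⟩
        w * (suc v * κ)                            ∎
      Y≤ : 2 ^ v * Y w ≤ u * (2 + v) * κ
      Y≤ = begin
        2 ^ v * (u * ballot (suc ℓ) u + S)          ≡⟨ lem₃ (2 ^ v) u (ballot (suc ℓ) u) S ⟩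
        u * (2 ^ v * ballot (suc ℓ) u) + 2 ^ v * S  ≤⟨ +-mono-≤ (*-monoʳ-≤ u A≤) B≤ ⟩
        u * κ + w * (suc v * κ)                     ≤⟨ +-monoʳ-≤ (u * κ) (*-monoˡ-≤ (suc v * κ) (m≤n+m w 2)) ⟩
        u * κ + u * (suc v * κ)                     ≡⟨ lem₄ u κ v ⟩
        u * (2 + v) * κ                             ∎
        where
        S : ℕ
        S = ∑ w (λ i → ballot ℓ (bound w i))
        lem₃ : ∀ q u b S → q * (u * b + S) ≡ u * (q * b) + q * S
        lem₃ = solve-∀
        lem₄ : ∀ u κ v → u * κ + u * ((1 + v) * κ) ≡ u * (2 + v) * κ
        lem₄ = solve-∀

  -- The factor 2 covers the two values u = 2v and u = 2v + 1 that share v.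
  β : ℕ → ℕ
  β v = 2 * ((1 + 2 * v) * ((1 + 2 * v) * ((1 + 2 * v) * (2 + v))))

  -- For v ≥ 20 each of the four linear factors of β grows by at most 11/10, and
  -- 4 (11/10)⁴ ≤ 6.
  β-suc : ∀ v → 20 ≤ v → 2 * β v + 4 * β (suc v) ≤ 2 * (4 * β v)
  β-suc v 20≤v = begin
    2 * β v + 4 * β (suc v)   ≤⟨ +-monoʳ-≤ (2 * β v) (*-cancelˡ-≤ 10000 scaled-≤) ⟩
    2 * β v + 6 * β v         ≡⟨ lem (β v) ⟩
    2 * (4 * β v)             ∎
    where
    open ≤-Reasoning
    lem : ∀ b → 2 * b + 6 * b ≡ 2 * (4 * b)
    lem = solve-∀
    A A′ D D′ : ℕ
    A  = 1 + 2 * v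
    A′ = 1 + 2 * suc v
    D  = 2 + v
    D′ = 2 + suc v
    collect : ∀ k c a d → k * (c * c * c * c * (2 * (a * (a * (a * d))))) ≡ k * (2 * ((c * a) * ((c * a) * ((c * a) * (c * d)))))
    collect = solve-∀
    A≤ : 10 * A′ ≤ 11 * A
    A≤ = begin
      10 * A′                   ≡⟨ lem₁ v ⟩
      (11 + 20 * v) + 19        ≤⟨ +-monoʳ-≤ (11 + 20 * v) (≤-trans (≤-trans (n≤1+n 19) 20≤v) (m≤m+n v (v + 0))) ⟩
      (11 + 20 * v) + 2 * v     ≡⟨ lem₂ v ⟩
      11 * A                    ∎
      where
      lem₁ : ∀ v → 10 * (1 + 2 * suc v) ≡ (11 + 20 * v) + 19
      lem₁ = solve-∀
      lem₂ : ∀ v → (11 + 20 * v) + 2 * v ≡ 11 * (1 + 2 * v)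
      lem₂ = solve-∀
    D≤ : 10 * D′ ≤ 11 * D
    D≤ = begin
      10 * D′                   ≡⟨ lem₁ v ⟩
      (22 + 10 * v) + 8         ≤⟨ +-monoʳ-≤ (22 + 10 * v) (≤-trans (m≤m+n 8 12) 20≤v) ⟩
      (22 + 10 * v) + v         ≡⟨ lem₂ v ⟩
      11 * D                    ∎
      where
      lem₁ : ∀ v → 10 * (2 + suc v) ≡ (22 + 10 * v) + 8
      lem₁ = solve-∀
      lem₂ : ∀ v → (22 + 10 * v) + v ≡ 11 * (2 + v)
      lem₂ = solve-∀
    scaled-≤ : 10000 * (4 * β (suc v)) ≤ 10000 * (6 * β v)
    scaled-≤ = begin
      10000 * (4 * β (suc v))                 ≡⟨ swap₁ 10000 4 (β (suc v)) ⟩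
      4 * (10000 * β (suc v))                 ≡⟨ collect 4 10 A′ D′ ⟩
      4 * (2 * (10 * A′ * (10 * A′ * (10 * A′ * (10 * D′))))) ≤⟨ *-monoʳ-≤ 4 (*-monoʳ-≤ 2 (*-mono-≤ A≤ (*-mono-≤ A≤ (*-mono-≤ A≤ D≤)))) ⟩
      4 * (2 * (11 * A * (11 * A * (11 * A * (11 * D)))))     ≡⟨ sym (collect 4 11 A D) ⟩
      4 * (14641 * β v)                       ≡⟨ sym (*-assoc 4 14641 (β v)) ⟩
      58564 * β v                             ≤⟨ *-monoˡ-≤ (β v) (≤ᵇ⇒≤ 58564 60000 tt) ⟩
      60000 * β v                             ≡⟨ *-assoc 10000 6 (β v) ⟩
      10000 * (6 * β v)                       ∎
      where
      swap₁ : ∀ a b c → a * (b * c) ≡ b * (a * c)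
      swap₁ = solve-∀

  tail-≤ : ∀ n → ∑ n (λ x → σ (38 + x) * Y (38 + x)) ≤ 12 * κ
  tail-≤ n = go (2 ^ 20) refl ⦃ m^n≢0 2 20 ⦄
    where
    open ≤-Reasoning
    f : ℕ → ℕ
    f x = σ (38 + x) * Y (38 + x)
    pair : ℕ → ℕ
    pair i = ∑ 2 (λ ρ → f (i * 2 + ρ))
    term : ∀ i ρ → ρ ≤ 1 → let v = i + 20 in
           2 ^ v * f (i * 2 + ρ) ≤ (1 + 2 * v) * ((1 + 2 * v) * ((1 + 2 * v) * (2 + v))) * κ
    term i ρ ρ≤1 = tail-term (i + 20) (38 + (i * 2 + ρ)) (m≤n+m 20 i)
      (≤-trans (m≤m+n _ ρ) (≤-reflexive (lem₁ i ρ)))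
      (≤-trans (≤-reflexive (lem₂ i ρ)) (≤-trans (+-monoʳ-≤ (40 + i * 2) ρ≤1) (≤-reflexive (lem₃ i))))
      where
      lem₁ : ∀ i ρ → i + 20 + (i + 20) + ρ ≡ 2 + (38 + (i * 2 + ρ))
      lem₁ = solve-∀
      lem₂ : ∀ i ρ → 2 + (38 + (i * 2 + ρ)) ≡ 40 + i * 2 + ρ
      lem₂ = solve-∀
      lem₃ : ∀ i → 40 + i * 2 + 1 ≡ 1 + 2 * (i + 20)
      lem₃ = solve-∀
    pair-≤ : ∀ i → 2 ^ (i + 20) * pair i ≤ β (i + 20) * κ
    pair-≤ i = ≤-trans (≤-reflexive (lem₁ (2 ^ (i + 20)) (f (i * 2 + 0)) (f (i * 2 + 1))))
      (≤-trans (+-mono-≤ (term i 0 z≤n) (term i 1 ≤-refl)) (≤-reflexive (lem₂ (let v = i + 20 in (1 + 2 * v) * ((1 + 2 * v) * ((1 + 2 * v) * (2 + v)))) κ)))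
      where
      lem₁ : ∀ q x y → q * (x + (y + 0)) ≡ q * x + q * y
      lem₁ = solve-∀
      lem₂ : ∀ b κ → b * κ + b * κ ≡ 2 * b * κ
      lem₂ = solve-∀
    go : ∀ Q → Q ≡ 2 ^ 20 → .⦃ _ : NonZero Q ⦄ → ∑ n f ≤ 12 * κ
    go Q Q≡ = *-cancelˡ-≤ Q (begin
      Q * ∑ n f                     ≤⟨ *-monoʳ-≤ Q (∑-mono-range f (m≤m*n n 2)) ⟩
      Q * ∑ (n * 2) f               ≡⟨ cong (Q *_) (∑-blocks n 2 f) ⟩
      Q * ∑ n pair                  ≡⟨ sym (∑-*ˡ n Q pair) ⟩
      ∑ n (λ i → Q * pair i)        ≤⟨ geometric-tail n (λ i → Q * pair i) (λ i → β (i + 20)) (λ i → 4 * β (i + 20)) κ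
                                         scaled-pair (λ i → β-suc (i + 20) (m≤n+m 20 i)) ⟩
      -- The constant 12 is 4 β(20) / 2^20, about 11.57, rounded up.
      4 * β 20 * κ                  ≤⟨ *-monoˡ-≤ κ (subst (λ q → 4 * β 20 ≤ q * 12) (sym Q≡) (≤ᵇ⇒≤ _ _ tt)) ⟩
      Q * 12 * κ                    ≡⟨ *-assoc Q 12 κ ⟩
      Q * (12 * κ)                  ∎)
      where
      scaled-pair : ∀ i → 2 ^ i * (Q * pair i) ≤ β (i + 20) * κ
      scaled-pair i = ≤-trans (≤-reflexive (trans (sym (*-assoc (2 ^ i) Q (pair i)))
        (cong (_* pair i) (trans (cong (2 ^ i *_) Q≡) (sym (^-distribˡ-+-* 2 i 20)))))) (pair-≤ i)

  ∑σY-≤ : ∀ n → 2 * ∑ n (λ w → σ w * Y w) ≤ 634 * κ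
  ∑σY-≤ n = begin
    2 * ∑ n g                                    ≤⟨ *-monoʳ-≤ 2 (∑-mono-range g (m≤n+m n 38)) ⟩
    2 * ∑ (38 + n) g                             ≡⟨ cong (2 *_) (∑-split 38 n g) ⟩
    2 * (∑ 38 g + ∑ n (λ x → g (38 + x)))        ≡⟨ *-distribˡ-+ 2 (∑ 38 g) _ ⟩
    2 * ∑ 38 g + 2 * ∑ n (λ x → g (38 + x))      ≤⟨ +-mono-≤ head-≤ (*-monoʳ-≤ 2 (tail-≤ n)) ⟩
    610 * κ + 2 * (12 * κ)                       ≡⟨ lem κ ⟩
    634 * κ                                      ∎
    where
    open ≤-Reasoning
    g : ℕ → ℕ
    g w = σ w * Y w
    lem : ∀ κ → 610 * κ + 2 * (12 * κ) ≡ 634 * κ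
    lem = solve-∀

-- Counting

m≤[m*n+o]/n : ∀ m n o .⦃ _ : NonZero n ⦄ → m ≤ (m * n + o) / n
m≤[m*n+o]/n m n o = ≤-trans (≤-reflexive (sym (m*n/n≡m m n))) (/-monoˡ-≤ n (m≤m+n (m * n) o))

module Count (k X : ℕ) (X-large : (3 + (suc k + suc k)) * ((3 + (suc k + suc k)) * suc (suc k)) ≤ X) where

  ℓ κ : ℕ
  ℓ = suc k
  κ = catalan ℓ

  open Enumeration ℓ X X-large

  length-cellsᵘ : ∀ u′ → length (cellsᵘ u′) ≡ ∑ (suc u′) (λ p′ → ∑ X (λ δ → length (cell (suc u′) (suc p′) δ)))
  length-cellsᵘ u′ = trans (length-⋃ (suc u′) (cellsᵖ u′)) (∑-cong (suc u′) (λ p′ → length-⋃ X (cell (suc u′) (suc p′))))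

  -- For u = 1 the depth takes each value from 1 on exactly once, so only the term K = 0 is missing
  -- from a full row of ballot numbers; the summand κ supplies it.
  length-cellsᵘ-0 : length (cellsᵘ 0) + κ ≡ catalan (suc ℓ)
  length-cellsᵘ-0 = begin
    length (cellsᵘ 0) + κ                               ≡⟨ cong₂ _+_ (trans (length-cellsᵘ 0) (+-identityʳ _)) (sym (ballot-zero ℓ)) ⟩
    ∑ X (λ δ → length (cell 1 1 δ)) + ballot ℓ 0        ≡⟨ cong (_+ ballot ℓ 0) (∑-cong X length-cell) ⟩
    ∑ X (λ δ → ballot ℓ (suc δ)) + ballot ℓ 0           ≡⟨ +-comm _ (ballot ℓ 0) ⟩
    ∑ (suc X) (ballot ℓ)                                ≡⟨ ∑-ballot (suc X) ℓ (≤-trans ℓ<X (n≤1+n X)) ⟩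
    catalan (suc ℓ)                                     ∎
    where
    open ≡-Reasoning
    length-cell : ∀ δ → length (cell 1 1 δ) ≡ ballot ℓ (suc δ)
    length-cell δ = trans (cong length (when-yes (admissible? 1 1 δ) (∣-refl , 1-coprimeTo (1 + suc δ))))
      (length-block 1 (1 + suc δ) (1 * (1 + suc δ)) (depth-q-1 (suc δ)))

  length-cell-≤ : ∀ w p′ δ J → let p = suc p′ ; q = p + suc δ in
    (∀ {K} → Depth (p + q) ((2 + w) * q) (suc K) → J ≤ K) → length (cell (2 + w) p δ) ≤ ballot ℓ J
  length-cell-≤ w p′ δ J J≤ with depth-suc (suc p′ + (suc p′ + suc δ)) {(2 + w) * (suc p′ + suc δ)} (s≤s z≤n)
  ... | K , D = ≤-trans (length-when (admissible? (2 + w) (suc p′) δ))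
    (≤-trans (≤-reflexive (length-block (suc p′) (suc p′ + suc δ) ((2 + w) * (suc p′ + suc δ)) D)) (ballot-decreasing ℓ (J≤ D)))

  module _ (w p′ : ℕ) where

    private
      p u : ℕ
      p = suc p′
      u = 2 + w
      f g : ℕ → ℕ
      f δ = length (cell u p δ)
      g i = ∑ p (λ ρ → f (i * p + ρ))

      p*i<s : ∀ i ρ → p * (2 + i) < p + (p + suc (i * p + ρ))
      p*i<s i ρ = ≤-trans (m≤m+n _ ρ) (≤-reflexive (lem p i ρ))
        where
        lem : ∀ p i ρ → 1 + p * (2 + i) + ρ ≡ p + (p + (1 + (i * p + ρ)))
        lem = solve-∀

      g-≤ : ∀ i → g i ≤ p * ballot ℓ (bound w i)
      g-≤ i = ≤-trans (∑-mono p (λ ρ → length-cell-≤ w p′ (i * p + ρ) (bound w i)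
          (λ D → depth-bound p (i * p + ρ) w (s≤s z≤n) D i (p*i<s i ρ)))) (≤-reflexive (∑-const p _))

      g-≤′ : ∀ j ρ → g (w + (j * u + ρ)) ≤ p * ballot ℓ (suc w + j)
      g-≤′ j ρ = ≤-trans (∑-mono p (λ ρ′ → length-cell-≤ w p′ (i * p + ρ′) (suc w + j)
          (λ D → ≤-trans J≤ (depth-bound′ p (i * p + ρ′) w (s≤s z≤n) D (2 + i) (s≤s (s≤s (m≤m+n w _))) (p*i<s i ρ′)))))
          (≤-reflexive (∑-const p _))
        where
        i : ℕ
        i = w + (j * u + ρ)
        J≤ : suc w + j ≤ bound′ w (2 + i)
        J≤ = ≤-trans (≤-reflexive (sym (+-suc w j)))
          (+-monoʳ-≤ w (≤-trans (m≤[m*n+o]/n (suc j) u ρ) (≤-reflexive (cong (_/ u) (lem w j ρ)))))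
          where
          lem : ∀ w j ρ → suc j * (2 + w) + ρ ≡ 2 + (w + (j * (2 + w) + ρ))
          lem = solve-∀

    -- Writing δ = i p + ρ with ρ < p makes p (i + 2) < p + q hold for each block i. The first `w`
    -- blocks are estimated by `bound`. The others are grouped in runs of u, on the j-th of which
    -- `bound′` is at least suc w + j, and the ballot numbers at these depths telescope over j.
    ∑-cell-≤ : ∑ X f ≤ p * Y ℓ w
    ∑-cell-≤ = begin
      ∑ X f                                              ≤⟨ ∑-mono-range f (m≤m*n X p) ⟩
      ∑ (X * p) f                                        ≡⟨ ∑-blocks X p f ⟩
      ∑ X g                                              ≤⟨ ∑-mono-range g (≤-trans (m≤m*n X u) (m≤n+m _ w)) ⟩
      ∑ (w + X * u) g                                    ≡⟨ ∑-split w (X * u) g ⟩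
      ∑ w g + ∑ (X * u) (λ i → g (w + i))                ≡⟨ cong (∑ w g +_) (∑-blocks X u (λ i → g (w + i))) ⟩
      ∑ w g + ∑ X (λ j → ∑ u (λ ρ → g (w + (j * u + ρ)))) ≤⟨ +-mono-≤ (∑-mono w g-≤) (∑-mono X (λ j → ∑-mono u (g-≤′ j))) ⟩
      ∑ w (λ i → p * ballot ℓ (bound w i)) + ∑ X (λ j → ∑ u (λ _ → p * t j))
        ≡⟨ cong₂ _+_ (∑-*ˡ w p _) (trans (∑-cong X (λ j → trans (∑-const u (p * t j)) (lem₁ u p (t j))))
             (trans (∑-*ˡ X p (λ j → u * t j)) (cong (p *_) (∑-*ˡ X u t)))) ⟩
      p * S + p * (u * ∑ X t) ≤⟨ +-monoʳ-≤ (p * S) (*-monoʳ-≤ p (*-monoʳ-≤ u (∑-ballot-≤ X ℓ (suc w)))) ⟩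
      p * S + p * (u * ballot (suc ℓ) (2 + w))           ≡⟨ lem₂ p S _ ⟩
      p * Y ℓ w                                          ∎
      where
      open ≤-Reasoning
      S : ℕ
      S = ∑ w (λ i → ballot ℓ (bound w i))
      t : ℕ → ℕ
      t j = ballot ℓ (suc w + j)
      lem₁ : ∀ a b c → a * (b * c) ≡ b * (a * c)
      lem₁ = solve-∀
      lem₂ : ∀ p S B → p * S + p * B ≡ p * (B + S)
      lem₂ = solve-∀

    ∑-cell-≤-weight : (d : Dec (p ∣ u)) → ∑ X f ≤ weight d p * Y ℓ w
    ∑-cell-≤-weight (yes _)  = ∑-cell-≤
    ∑-cell-≤-weight (no p∤u) = ≤-reflexive (trans
      (∑-cong X (λ δ → cong length (when-no (admissible? u p δ) (λ adm → p∤u (proj₁ adm)))))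
      (trans (∑-const X 0) (*-zeroʳ X)))

  length-cellsᵘ-≤ : ∀ w → length (cellsᵘ (suc w)) ≤ σ w * Y ℓ w
  length-cellsᵘ-≤ w = ≤-trans (≤-reflexive (length-cellsᵘ (suc w)))
    (≤-trans (∑-mono (2 + w) (λ p′ → ∑-cell-≤-weight w p′ (suc p′ ∣? 2 + w)))
      (≤-reflexive (∑-*ʳ (2 + w) (Y ℓ w) (λ p′ → weight (suc p′ ∣? 2 + w) (suc p′)))))

  increasing-lower : catalan (suc ℓ) ≤ length increasing + κ
  increasing-lower = begin
    catalan (suc ℓ)           ≡⟨ sym length-cellsᵘ-0 ⟩
    length (cellsᵘ 0) + κ     ≤⟨ +-monoˡ-≤ κ first≤ ⟩
    length increasing + κ     ∎
    where
    open ≤-Reasoning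
    first≤ : length (cellsᵘ 0) ≤ length increasing
    first≤ = begin
      length (cellsᵘ 0)                 ≤⟨ m≤m+n _ 0 ⟩
      ∑ 1 (λ u′ → length (cellsᵘ u′))   ≤⟨ ∑-mono-range _ (≤-trans (s≤s z≤n) T≤X) ⟩
      ∑ X (λ u′ → length (cellsᵘ u′))   ≡⟨ sym (length-⋃ X cellsᵘ) ⟩
      length increasing                 ∎

  increasing-upper : 2 * (length increasing + κ) ≤ 2 * catalan (suc ℓ) + 634 * κ
  increasing-upper = begin
    2 * (length increasing + κ)                    ≡⟨ cong (λ z → 2 * (z + κ)) (length-⋃ X cellsᵘ) ⟩
    2 * (∑ X h + κ)                                ≤⟨ *-monoʳ-≤ 2 (+-monoˡ-≤ κ (∑-mono-range h (n≤1+n X))) ⟩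
    2 * (h 0 + ∑ X (λ w → h (suc w)) + κ)          ≤⟨ *-monoʳ-≤ 2 (+-monoˡ-≤ κ (+-monoʳ-≤ (h 0) (∑-mono X length-cellsᵘ-≤))) ⟩
    2 * (h 0 + ∑ X (λ w → σ w * Y ℓ w) + κ)        ≡⟨ lem (h 0) (∑ X (λ w → σ w * Y ℓ w)) κ ⟩
    2 * (h 0 + κ) + 2 * ∑ X (λ w → σ w * Y ℓ w)    ≤⟨ +-mono-≤ (≤-reflexive (cong (2 *_) length-cellsᵘ-0)) (∑σY-≤ ℓ X) ⟩
    2 * catalan (suc ℓ) + 634 * κ                  ∎
    where
    open ≤-Reasoning
    h : ℕ → ℕ
    h u′ = length (cellsᵘ u′)
    lem : ∀ a b c → 2 * (a + b + c) ≡ 2 * (a + c) + 2 * b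
    lem = solve-∀

  -- The vectors with p = q = 1

  private
    d : ℕ → ℕ
    d u′ = length (block 1 1 (suc u′))

    d-0 : d 0 ≡ κ
    d-0 = trans (length-block 1 1 1 (step (s≤s z≤n) (1∣ 2) stop)) (ballot-zero ℓ)

    d-1 : d 1 ≡ κ
    d-1 = trans (length-block 1 1 2 (step (s≤s z≤n) ∣-refl stop)) (ballot-zero ℓ)

    d-2 : d 2 ≡ κ
    -- The depth here is 1, and the ballot numbers at 0 and 1 agree only for ℓ ≥ 1; this is where n
    -- ≥ 4 enters.
    d-2 = trans (length-block 1 1 3 (step (s≤s (s≤s z≤n)) ∣-refl (step (s≤s z≤n) (1∣ 3) stop))) (ballot-one k)

    d-≤ : ∀ j → d (2 + j) ≤ ballot ℓ (suc (j / 2))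
    d-≤ j with depth-suc 2 {3 + j} (s≤s z≤n)
    ... | K , D = ≤-trans (≤-reflexive (length-block 1 1 (3 + j) D)) (ballot-decreasing ℓ (depth-1-1-≥ j D))

  diagonal-lower : 3 * κ ≤ length diagonal
  diagonal-lower = begin
    3 * κ                   ≡⟨ cong₂ _+_ (sym d-0) (cong₂ _+_ (sym d-1) (cong (_+ 0) (sym d-2))) ⟩
    ∑ 3 d                   ≤⟨ ∑-mono-range d (≤-trans (m≤m+n 3 _) T≤X) ⟩
    ∑ X d                   ≡⟨ sym (length-⋃ X _) ⟩
    length diagonal         ∎
    where open ≤-Reasoning

  -- The 10 is 1 + 1 + 2 · 4: r₀ = 1 and r₀ = 2 give κ each. From r₀ = 3 on, each depth bound 1, 2,
  -- ... serves two values of r₀, and a row of ballot numbers sums to at most C(ℓ + 1) ≤ 4 C(ℓ).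
  diagonal-upper : length diagonal ≤ 10 * κ
  diagonal-upper = begin
    length diagonal                                          ≡⟨ length-⋃ X _ ⟩
    ∑ X d                                                    ≤⟨ ∑-mono-range d (m≤n+m X 2) ⟩
    d 0 + (d 1 + ∑ X (λ j → d (2 + j)))                      ≡⟨ cong₂ (λ x y → x + (y + S)) d-0 d-1 ⟩
    κ + (κ + S)                                              ≤⟨ +-monoʳ-≤ κ (+-monoʳ-≤ κ S≤) ⟩
    κ + (κ + 2 * (4 * κ))                                    ≡⟨ lem κ ⟩
    10 * κ                                                   ∎
    where
    open ≤-Reasoning
    lem : ∀ c → c + (c + 2 * (4 * c)) ≡ 10 * c
    lem = solve-∀
    S : ℕ
    S = ∑ X (λ j → d (2 + j))
    b : ℕ → ℕ
    b j = ballot ℓ (suc (j / 2))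
    S≤ : S ≤ 2 * (4 * κ)
    S≤ = begin
      S                                            ≤⟨ ∑-mono X d-≤ ⟩
      ∑ X b                                        ≤⟨ ∑-mono-range b (m≤m*n X 2) ⟩
      ∑ (X * 2) b                                  ≡⟨ ∑-blocks X 2 b ⟩
      ∑ X (λ i → ∑ 2 (λ ρ → b (i * 2 + ρ)))        ≤⟨ ∑-mono X (λ i → ∑-mono 2 (λ ρ → ballot-decreasing ℓ (s≤s (m≤[m*n+o]/n i 2 ρ)))) ⟩
      ∑ X (λ i → 2 * ballot ℓ (1 + i))             ≡⟨ ∑-*ˡ X 2 _ ⟩
      2 * ∑ X (λ i → ballot ℓ (1 + i))             ≤⟨ *-monoʳ-≤ 2 (≤-trans (∑-ballot-≤ X ℓ 1) (ballot-decreasing-suc (suc ℓ) 1)) ⟩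
      2 * ballot (suc ℓ) 1                         ≡⟨ cong (2 *_) (ballot-one ℓ) ⟩
      2 * catalan (suc ℓ)                          ≤⟨ *-monoʳ-≤ 2 (catalan-suc-≤ ℓ) ⟩
      2 * (4 * κ)                                  ∎

  lower : 2 * catalan (suc ℓ) + κ ≤ length structures
  -- The count is at least 2 (C(ℓ + 1) - κ) + 3 κ; adding 2 κ on both sides avoids the subtraction.
  lower = +-cancelʳ-≤ (2 * κ) _ _ (begin
    2 * catalan (suc ℓ) + κ + 2 * κ                    ≡⟨ lem₁ (catalan (suc ℓ)) κ ⟩
    2 * catalan (suc ℓ) + 3 * κ                        ≤⟨ +-mono-≤ (*-monoʳ-≤ 2 increasing-lower) diagonal-lower ⟩
    2 * (length increasing + κ) + length diagonal      ≡⟨ lem₂ (length increasing) κ (length diagonal) ⟩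
    2 * length increasing + length diagonal + 2 * κ    ≡⟨ cong (_+ 2 * κ) (sym length-structures) ⟩
    length structures + 2 * κ                          ∎)
    where
    open ≤-Reasoning
    lem₁ : ∀ a c → 2 * a + c + 2 * c ≡ 2 * a + 3 * c
    lem₁ = solve-∀
    lem₂ : ∀ i c e → 2 * (i + c) + e ≡ 2 * i + e + 2 * c
    lem₂ = solve-∀

  upper : length structures < 2 * catalan (suc ℓ) + 702 * κ
  upper = begin-strict
    length structures                                  ≡⟨ length-structures ⟩
    2 * length increasing + length diagonal            ≤⟨ +-mono-≤ (*-monoʳ-≤ 2 (m≤m+n (length increasing) κ)) diagonal-upper ⟩
    2 * (length increasing + κ) + 10 * κ               ≤⟨ +-monoˡ-≤ (10 * κ) increasing-upper ⟩
    2 * catalan (suc ℓ) + 634 * κ + 10 * κ             ≡⟨ lem (catalan (suc ℓ)) κ ⟩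
    2 * catalan (suc ℓ) + 644 * κ                      <⟨ +-monoʳ-< (2 * catalan (suc ℓ)) (*-monoˡ-< κ ⦃ >-nonZero (catalan-positive ℓ) ⦄ (m≤m+n 645 57)) ⟩
    2 * catalan (suc ℓ) + 702 * κ                      ∎
    where
    open ≤-Reasoning
    lem : ∀ a c → 2 * a + 634 * c + 10 * c ≡ 2 * a + 644 * c
    lem = solve-∀

  count : Σ ℕ (λ n → HasCardinality (ArithBident (3 + ℓ)) n ×
    (2 * catalan (suc ℓ) + catalan ℓ ≤ n) × (n < 2 * catalan (suc ℓ) + 702 * catalan ℓ))
  count = length structures , (structures , structures-unique , ∈-structures , refl) , lower , upper

theorem4p9 : (n : ℕ) → 4 ≤ n →
    Σ ℕ (λ k → HasCardinality (ArithBident n) k ×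
    (2 * catalan (n ∸ 2) + catalan (n ∸ 3) ≤ k) ×
    (k < 2 * catalan (n ∸ 2) + 702 * catalan (n ∸ 3)))
theorem4p9 _ (s≤s (s≤s (s≤s (s≤s {n = k} z≤n)))) = Count.count k _ ≤-refl
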